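{- Let $\mathcal{M}$ be a positroid on $[n]$ without loops or coloops. Let $s\ge 1$ and let $E=[a_1,b_1]\cup\cdots\cup[a_s,b_s]\subseteq[n]$ be a disjoint union of $s$ cyclic intervals such that $a_1,b_1,a_2,b_2,\ldots,a_s,b_s$ are cyclically ordered, i.e. they appear in this order going around the circle $1\to 2\to\cdots\to n\to 1$ (with $a_i=b_i$ allowed). Then there exists a non-crossing partition $\Pi=T_1\sqcup\cdots\sqcup T_p$ of $[s]$ such that $$\operatorname{rk}(E)=\sum_{j=1}^{p}\operatorname{nbd}(E|_{T_j}).$$
   Context: Cyclic intervals: for $a,b\in[n]$, $[a,b]$ is the set $\{a,a+1,\ldots,b\}$ read cyclically modulo $n$ (so $[a,a]=\{a\}$), and $(a,b):=[n]\setminus[b,a]$. A positroid of rank $d$ on $[n]$ is a matroid whose bases are exactly the $d$-subsets $B\subseteq[n]$ such that the $d\times d$ minor on the columns $B$ of some fixed real $d\times n$ matrix of rank $d$, all of whose maximal minors are nonnegative, is nonzero. A loop is an element in no basis; a coloop is an element in every basis. $\operatorname{rk}(A)$ is the maximum of $|A\cap B|$ over bases $B$, and $\operatorname{rk}(\mathcal{M})=\operatorname{rk}([n])$. For cyclic endpoints $b,a$, let $m(b,a):=\min_{B}|B\cap(b,a)|$ over all bases $B$ of $\mathcal{M}$. For a subset $T=\{i_1<\cdots<i_m\}\subseteq[s]$, let $E|_T=\bigcup_{i\in T}[a_i,b_i]$ and define $\operatorname{nbd}(E|_T):=\operatorname{rk}(\mathcal{M})-\sum_{j=1}^{m} m(b_{i_j},a_{i_{j+1}})$,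 with $i_{m+1}=i_1$ (so for $m=1$ the single term is $m(b_{i_1},a_{i_1})$, the minimal number of basis elements in the complement of $[a_{i_1},b_{i_1}]$). A partition $T_1\sqcup\cdots\sqcup T_p$ of $[s]$ into nonempty blocks is non-crossing if there are no $x<y<z<w$ in $[s]$ with $x,z\in T_i$ and $y,w\in T_j$ for some $i\neq j$.
   Formalization: The positroid is given by a totally nonnegative matrix with rational entries instead of real entries; that every positroid has such a rational representation is a known theorem (Postnikov) that is not proved here. -}

module Defs where

open import Data.Nat as ℕ using (ℕ; zero; suc; _∸_; _⊔_; _⊓_; _≤ᵇ_)
open import Data.Bool using (Bool; true; false; not; if_then_else_; _∨_)
open import Data.Fin using (Fin; zero; suc; toℕ; punchIn; _<_)
open import Data.Fin.Properties using () renaming (_≟_ to _≟F_)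
open import Data.Vec as Vec using (Vec; []; _∷_; lookup)
open import Data.List as List using (List; []; _∷_; _++_; filter)
open import Data.List.Relation.Unary.All using (All)
open import Data.List.Relation.Unary.Any using (Any)
open import Data.Vec.Membership.Propositional using (_∈_; _∉_)
open import Data.Rational as ℚ using (ℚ; 0ℚ; 1ℚ; _≟_)
open import Data.Integer as ℤ using (ℤ; +_)
open import Data.Unit using (⊤)
open import Data.Product using (Σ; ∃; _×_; _,_)
open import Relation.Nullary using (¬_; ¬?)
open import Relation.Binary.PropositionalEquality using (_≡_; _≢_)

-- Ground set [n] is modelled by Fin n; element i ∈ Fin n stands for i+1.

sumQ : ∀ {k} → (Fin k → ℚ) → ℚ
sumQ {zero} f = 0ℚ
sumQ {suc k} f = f zero ℚ.+ sumQ (λ i → f (suc i))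

sgn : ℕ → ℚ
sgn zero = 1ℚ
sgn (suc m) = ℚ.- sgn m

det : ∀ k → (Fin k → Fin k → ℚ) → ℚ
det zero M = 1ℚ
det (suc k) M =
  sumQ (λ j → sgn (toℕ j) ℚ.* (M zero j ℚ.* det k (λ r c → M (suc r) (punchIn j c))))

combs : ∀ {A : Set} k {m} → Vec A m → List (Vec A k)
combs zero _ = [] ∷ []
combs (suc k) [] = []
combs (suc k) (x ∷ xs) = List.map (x ∷_) (combs k xs) ++ combs (suc k) xs

dSubsets : (d n : ℕ) → List (Vec (Fin n) d)
dSubsets d n = combs d (Vec.allFin n)

Matrix : ℕ → ℕ → Set
Matrix d n = Fin d → Fin n → ℚ

minor : ∀ {d n} → Matrix d n → Vec (Fin n) d → ℚ
minor {d} A c = det d (λ i j → A i (lookup c j))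

TotallyNonneg : ∀ {d n} → Matrix d n → Set
TotallyNonneg {d} {n} A = All (λ c → 0ℚ ℚ.≤ minor A c) (dSubsets d n)

FullRank : ∀ {d n} → Matrix d n → Set
FullRank {d} {n} A = Any (λ c → minor A c ≢ 0ℚ) (dSubsets d n)

bases : ∀ {d n} → Matrix d n → List (Vec (Fin n) d)
bases {d} {n} A = filter (λ c → ¬? (minor A c ≟ 0ℚ)) (dSubsets d n)

NoLoops : ∀ {d n} → Matrix d n → Set
NoLoops {d} {n} A = ∀ (x : Fin n) → Any (λ B → x ∈ B) (bases A)

NoColoops : ∀ {d n} → Matrix d n → Set
NoColoops {d} {n} A = ∀ (x : Fin n) → Any (λ B → x ∉ B) (bases A)

countIn : ∀ {n k} → (Fin n → Bool) → Vec (Fin n) k → ℕ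
countIn S [] = 0
countIn S (x ∷ xs) = (if S x then 1 else 0) ℕ.+ countIn S xs

rk : ∀ {d n} → Matrix d n → (Fin n → Bool) → ℕ
rk A S = List.foldr (λ B r → countIn S B ⊔ r) 0 (bases A)

-- min over bases of |S ∩ B| (the default n is never below a count, and bases are nonempty)
minCount : ∀ {d n} → Matrix d n → (Fin n → Bool) → ℕ
minCount {n = n} A S = List.foldr (λ B r → countIn S B ⊓ r) n (bases A)

dist : ∀ {n} → Fin n → Fin n → ℕ
dist {n} a x = if toℕ a ≤ᵇ toℕ x then toℕ x ∸ toℕ a else (n ℕ.+ toℕ x) ∸ toℕ a

inCI : ∀ {n} → Fin n → Fin n → Fin n → Bool
inCI a b x = dist a x ≤ᵇ dist a b

inOI : ∀ {n} → Fin n → Fin n → Fin n → Bool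
inOI a b x = not (inCI b a x)

mBA : ∀ {d n} → Matrix d n → Fin n → Fin n → ℕ
mBA A b a = minCount A (inOI b a)

anyF : ∀ {s} → (Fin s → Bool) → Bool
anyF {zero} f = false
anyF {suc s} f = f zero ∨ anyF (λ i → f (suc i))

unionCI : ∀ {n s} → (Fin s → Fin n) → (Fin s → Fin n) → Fin n → Bool
unionCI a b x = anyF (λ i → inCI (a i) (b i) x)

-- a_1,b_1,...,a_s,b_s cyclically ordered: measured forward from a_1 the
-- positions are weakly increasing (a_i ≤ b_i, and b_i < a_j for i < j)
CyclicallyOrdered : ∀ {n s} → (Fin s → Fin n) → (Fin s → Fin n) → Set
CyclicallyOrdered {s = zero} a b = ⊤   -- vacuous; the theorem assumes s ≥ 1
CyclicallyOrdered {n} {suc s} a b =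
  (∀ i → dist (a zero) (a i) ℕ.≤ dist (a zero) (b i)) ×
  (∀ i j → i < j → dist (a zero) (b i) ℕ.< dist (a zero) (a j))

Disjoint : ∀ {n s} → (Fin s → Fin n) → (Fin s → Fin n) → Set
Disjoint a b = ∀ i j → i ≢ j → ∀ x → inCI (a i) (b i) x ≡ true → inCI (a j) (b j) x ≡ false

cyclicPairs : ∀ {A : Set} → List A → List (A × A)
cyclicPairs {A} [] = []
cyclicPairs {A} (x ∷ xs) = go (x ∷ xs)
  where
  go : List A → List (A × A)
  go [] = []
  go (y ∷ []) = (y , x) ∷ []
  go (y ∷ z ∷ zs) = (y , z) ∷ go (z ∷ zs)

-- nbd(E|_T) for T = {i_1 < ... < i_m} given as an increasing list
nbd : ∀ {d n s} → Matrix d n → (Fin s → Fin n) → (Fin s → Fin n) → List (Fin s) → ℤ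
nbd {n = n} A a b T =
  + rk A (λ _ → true) ℤ.- List.foldr (λ p r → + mBA A (b (Data.Product.proj₁ p)) (a (Data.Product.proj₂ p)) ℤ.+ r) (+ 0) (cyclicPairs T)
  where import Data.Product

-- Set partition of [s] into p nonempty blocks, via block labels
Surjective : ∀ {s p} → (Fin s → Fin p) → Set
Surjective {s} blk = ∀ j → ∃ λ (i : Fin s) → blk i ≡ j

NonCrossing : ∀ {s p} → (Fin s → Fin p) → Set
NonCrossing blk = ∀ x y z w → x < y → y < z → z < w →
  blk x ≡ blk z → blk y ≡ blk w → blk x ≡ blk y

block : ∀ {s p} → (Fin s → Fin p) → Fin p → List (Fin s)
block {s} blk j = filter (λ i → blk i ≟F j) (List.allFin s)

sumZ : ∀ {k} → (Fin k → ℤ) → ℤ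
sumZ {zero} f = + 0
sumZ {suc k} f = f zero ℤ.+ sumZ (λ i → f (suc i))

{-# OPTIONS --safe #-}
-- Let r = rk(E), and call a basis optimal if it has r elements in E; the optimal bases
-- are those of M|E ⊕ M/E. If u, v ∉ E and x, y ∈ E alternate around the circle, then
-- optimal bases cannot exchange both u for v and x for y: by the direct sum
-- decomposition W ∪ {x,u}, W ∪ {x,v}, W ∪ {y,u}, W ∪ {y,v} would be bases for a common W,
-- and the three-term Plücker relation p_xy p_uv = p_xu p_yv + p_xv p_yu (signs as for a
-- totally nonnegative matrix) would make W ∪ {x,y} a basis with r + 1 elements in E.
-- Now either every optimal basis attains m on each gap between consecutive intervals, and
-- then rk(E) = nbd(E); or optimal bases exchange some u in a gap for some v in another
-- gap. In that case no exchange joins the intervals between u and v to the others, so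
-- rk(E) is the sum of the ranks of these two noncrossing parts, and one recurses.
module Submission where

open import Defs
open import Data.Bool as Bool using (Bool; true; false; not; if_then_else_; _∨_)
open import Data.Empty using (⊥)
open import Data.Fin as Fin using (Fin; zero; suc; toℕ; punchIn; _↑ˡ_; _↑ʳ_)
import Data.Fin.Properties as Fin
open import Data.List as List using (List; []; _∷_; _++_; filter; foldr; length; tabulate)
import Data.List.Properties as List
import Data.List.Membership.DecPropositional as DecMembership
open import Data.List.Membership.Propositional using (find; lose) renaming (_∈_ to _∈ˡ_; _∉_ to _∉ˡ_)
open import Data.List.Membership.Propositional.Properties
  using (∈-∃++; ∈-++⁻; ∈-++⁺ˡ; ∈-++⁺ʳ; ∈-map⁺; ∈-filter⁺; ∈-filter⁻; ∈-allFin)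
open import Data.List.Membership.Propositional.Properties.WithK using (unique∧set⇒bag)
open import Data.List.Relation.Binary.BagAndSetEquality using (∼bag⇒↭)
open import Data.List.Relation.Binary.Permutation.Propositional
  using (_↭_; prep; swap; ↭-sym; ↭-trans; ↭-refl; ↭-reflexive)
import Data.List.Relation.Binary.Permutation.Propositional as Perm
open import Data.List.Relation.Binary.Permutation.Propositional.Properties
  using (shift; drop-mid; ∈-resp-↭; filter-↭; ++⁺ˡ; ↭-length)
open import Data.List.Relation.Binary.Sublist.Propositional using (_⊆_; []; _∷_; _∷ʳ_)
open import Data.List.Relation.Binary.Sublist.Propositional.Properties using (filter-⊆; length-mono-≤)
open import Data.List.Relation.Unary.All as All using (All; []; _∷_)
import Data.List.Relation.Unary.All.Properties as All
open import Data.List.Relation.Unary.AllPairs as AllPairs using (AllPairs; []; _∷_)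
import Data.List.Relation.Unary.AllPairs.Properties as AllPairs
open import Data.List.Relation.Unary.Any using (here; there)
open import Data.List.Relation.Unary.Unique.Propositional using (Unique)
import Data.List.Relation.Unary.Unique.Propositional.Properties as Unique
open import Data.Nat as ℕ using (ℕ; zero; suc; _⊔_; _⊓_; _≤_)
import Data.Nat.Properties as ℕ
open import Data.Nat.Tactic.RingSolver using (solve-∀)
open import Data.Product using (∃; _×_; _,_; proj₁; proj₂)
open import Data.Rational as ℚ using (ℚ; 0ℚ; 1ℚ)
import Data.Rational.Properties as ℚ
open import Data.Rational.Solver using (module +-*-Solver)
open import Data.Sum using (_⊎_; inj₁; inj₂; [_,_]′)
open import Data.Vec as Vec using (Vec; []; _∷_; lookup)
open import Function using (_∘_; mk⇔)
open import Relation.Binary.PropositionalEquality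
  using (_≡_; _≢_; refl; sym; trans; cong; cong₂; subst; subst₂; module ≡-Reasoning)
open import Relation.Nullary using (¬_; ¬?; Dec; yes; no; ofʸ; ofⁿ; contradiction; _×-dec_)
import Relation.Unary as Unary

-- Determinants as alternating forms on lists of columns

-- Optimal bases can replace arbitrary ones in every count. Moving the part in E of an optimal basis
-- into any basis never raises its count on a gap, so each minimum `m` is attained by an optimal
-- basis; moving the part of any basis in a subset S of E into an optimal basis keeps it optimal, so
-- the rank of S is attained there too. Two optimal bases with different counts on a set force a
-- single exchange across it. Hence, if no exchange joins two parts of E, each part has a constant
-- count, and one optimal basis attains both ranks. If some optimal basis attains every `m`, then
-- rk(E) = nbd(E), because E and the gaps partition [n] and every basis has d elements. The obstacle
-- is the signs: the minors are nonnegative for increasing columns only, whereas exchange ignores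
-- the order. Bases are therefore lists on which `D` alternates, and multiplying `D` by the sign `ε`
-- of the sorting permutation makes it nonnegative in every order. The recursion shrinks the set of
-- intervals and keeps the matroid, so `m` always ranges over the same bases.

module Minors where
  open import Data.Rational using (_+_; _*_; _-_; -_)

  *-nonzero : ∀ {p q} → p ≢ 0ℚ → q ≢ 0ℚ → p * q ≢ 0ℚ
  *-nonzero {p} {q} p≢0 q≢0 pq≡0 = q≢0 (begin
    q                          ≡⟨ ℚ.*-identityˡ q ⟨
    1ℚ * q                   ≡⟨ cong (_* q) (ℚ.*-inverseˡ p {{p≠0}}) ⟨
    (ℚ.1/ p) {{p≠0}} * p * q ≡⟨ ℚ.*-assoc ((ℚ.1/ p) {{p≠0}}) p q ⟩
    (ℚ.1/ p) {{p≠0}} * (p * q) ≡⟨ cong ((ℚ.1/ p) {{p≠0}} *_) pq≡0 ⟩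
    (ℚ.1/ p) {{p≠0}} * 0ℚ    ≡⟨ ℚ.*-zeroʳ ((ℚ.1/ p) {{p≠0}}) ⟩
    0ℚ                         ∎)
    where
    open ≡-Reasoning
    p≠0 = ℚ.≢-nonZero p≢0

  p≡-p⇒p≡0 : ∀ {p} → p ≡ - p → p ≡ 0ℚ
  p≡-p⇒p≡0 {p} eq with p ℚ.≟ 0ℚ
  ... | yes p≡0 = p≡0
  ... | no  p≢0 = contradiction
    (trans (solve 1 (λ x → (con 1ℚ :+ con 1ℚ) :* x := x :+ x) refl p)
      (trans (cong (p +_) eq) (ℚ.+-inverseʳ p)))
    (*-nonzero {1ℚ + 1ℚ} (λ ()) p≢0)
    where open +-*-Solver

  module _ {X : Set} where

    -- Interior product: contracts the alternating form g on lists of vectors with φ.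
    -- Iterating it is Laplace expansion along the rows.
    ι : (X → ℚ) → (List X → ℚ) → List X → ℚ
    ι φ g []       = 0ℚ
    ι φ g (x ∷ xs) = φ x * g xs - ι φ (g ∘ (x ∷_)) xs

    D : List (X → ℚ) → List X → ℚ
    D []         []      = 1ℚ
    D []         (_ ∷ _) = 0ℚ
    D (φ ∷ rows) xs      = ι φ (D rows) xs

    ι-cong : ∀ {φ ψ g h} → (∀ x → φ x ≡ ψ x) → (∀ ys → g ys ≡ h ys) → ∀ xs → ι φ g xs ≡ ι ψ h xs
    ι-cong φ≈ψ g≈h []       = refl
    ι-cong φ≈ψ g≈h (x ∷ xs) =
      cong₂ _-_ (cong₂ ℚ._*_ (φ≈ψ x) (g≈h xs)) (ι-cong φ≈ψ (g≈h ∘ (x ∷_)) xs)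

    ι-linear-form : ∀ k l g h φ xs →
      ι φ (λ ys → k * g ys + l * h ys) xs ≡ k * ι φ g xs + l * ι φ h xs
    ι-linear-form k l g h φ []       = solve 2 (λ k l → con 0ℚ := k :* con 0ℚ :+ l :* con 0ℚ) refl k l
      where open +-*-Solver
    ι-linear-form k l g h φ (x ∷ xs) rewrite ι-linear-form k l (g ∘ (x ∷_)) (h ∘ (x ∷_)) φ xs =
      solve 7 (λ k l f a b c d → f :* (k :* a :+ l :* b) :- (k :* c :+ l :* d)
                              := k :* (f :* a :- c) :+ l :* (f :* b :- d)) refl
        k l (φ x) (g xs) (h xs) (ι φ (g ∘ (x ∷_)) xs) (ι φ (h ∘ (x ∷_)) xs)
      where open +-*-Solver

    ι-linear-row : ∀ k l φ ψ g xs →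
      ι (λ x → k * φ x + l * ψ x) g xs ≡ k * ι φ g xs + l * ι ψ g xs
    ι-linear-row k l φ ψ g []       = solve 2 (λ k l → con 0ℚ := k :* con 0ℚ :+ l :* con 0ℚ) refl k l
      where open +-*-Solver
    ι-linear-row k l φ ψ g (x ∷ xs) rewrite ι-linear-row k l φ ψ (g ∘ (x ∷_)) xs =
      solve 7 (λ k l a b f c d → (k :* a :+ l :* b) :* f :- (k :* c :+ l :* d)
                              := k :* (a :* f :- c) :+ l :* (b :* f :- d)) refl
        k l (φ x) (ψ x) (g xs) (ι φ (g ∘ (x ∷_)) xs) (ι ψ (g ∘ (x ∷_)) xs)
      where open +-*-Solver

    -- Expanding along two rows in either order differs by a sign. This is the alternation of `D` in
    -- its rows, which the row-by-row definition hides.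
    ι-anticommute : ∀ φ ψ g xs → ι φ (ι ψ g) xs ≡ - ι ψ (ι φ g) xs
    ι-anticommute φ ψ g []       = refl
    ι-anticommute φ ψ g (x ∷ xs) = begin
      φ x * ι ψ g xs - ι φ (ι ψ g ∘ (x ∷_)) xs
        ≡⟨ cong (λ t → φ x * ι ψ g xs - t) (contract-head φ ψ) ⟩
      φ x * ι ψ g xs - (ψ x * ι φ g xs + - 1ℚ * ι φ (ι ψ g′) xs)
        ≡⟨ cong (λ t → φ x * ι ψ g xs - (ψ x * ι φ g xs + - 1ℚ * t)) (ι-anticommute φ ψ g′ xs) ⟩
      φ x * ι ψ g xs - (ψ x * ι φ g xs + - 1ℚ * - ι ψ (ι φ g′) xs)
        ≡⟨ solve 3 (λ a b c → a :- (b :+ con (- 1ℚ) :* :- c) := :- (b :- (a :+ con (- 1ℚ) :* c)))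
             refl (φ x * ι ψ g xs) (ψ x * ι φ g xs) (ι ψ (ι φ g′) xs) ⟩
      - (ψ x * ι φ g xs - (φ x * ι ψ g xs + - 1ℚ * ι ψ (ι φ g′) xs))
        ≡⟨ cong (λ t → - (ψ x * ι φ g xs - t)) (contract-head ψ φ) ⟨
      - (ψ x * ι φ g xs - ι ψ (ι φ g ∘ (x ∷_)) xs) ∎
      where
      open ≡-Reasoning
      open +-*-Solver
      g′ = g ∘ (x ∷_)
      contract-head : ∀ φ ψ → ι φ (ι ψ g ∘ (x ∷_)) xs ≡ ψ x * ι φ g xs + - 1ℚ * ι φ (ι ψ g′) xs
      contract-head φ ψ = trans
        (ι-cong (λ _ → refl) (λ ys → solve 2 (λ a b → a :- b := a :+ con (- 1ℚ) :* b) refl (ψ x * g ys) (ι ψ g′ ys)) xs)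
        (ι-linear-form (ψ x) (- 1ℚ) g (ι ψ g′) φ xs)

    -- Contains the span of rows.
    Dependent : List (X → ℚ) → (X → ℚ) → Set
    Dependent rows φ = ∀ xs → D (φ ∷ rows) xs ≡ 0ℚ

    ι-zero : ∀ φ {g} → (∀ xs → g xs ≡ 0ℚ) → ∀ xs → ι φ g xs ≡ 0ℚ
    ι-zero φ g≡0 []       = refl
    ι-zero φ g≡0 (x ∷ xs) rewrite g≡0 xs | ι-zero φ (g≡0 ∘ (x ∷_)) xs =
      solve 1 (λ a → a :* con 0ℚ :- con 0ℚ := con 0ℚ) refl (φ x)
      where open +-*-Solver

    -- A repeated leading row makes `D` its own negative; for a repetition further down, the new row
    -- is first moved past the rows above it.
    row-dependent : ∀ {rows φ} → φ ∈ˡ rows → Dependent rows φ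
    row-dependent {ψ ∷ rows} {φ} (here refl) xs = p≡-p⇒p≡0 (ι-anticommute φ φ (D rows) xs)
    row-dependent {ψ ∷ rows} {φ} (there φ∈)  xs =
      trans (ι-anticommute φ ψ (D rows) xs) (cong -_ (ι-zero ψ (row-dependent φ∈) xs))

    Dependent-linear : ∀ rows {φ ψ χ} k l → (∀ x → χ x ≡ k * φ x + l * ψ x) →
      Dependent rows φ → Dependent rows ψ → Dependent rows χ
    Dependent-linear rows {φ} {ψ} k l eq depφ depψ xs = begin
      ι _ (D rows) xs                                   ≡⟨ ι-cong eq (λ _ → refl) xs ⟩
      ι (λ x → k * φ x + l * ψ x) (D rows) xs     ≡⟨ ι-linear-row k l φ ψ (D rows) xs ⟩
      k * D (φ ∷ rows) xs + l * D (ψ ∷ rows) xs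
        ≡⟨ cong₂ (λ a b → k * a + l * b) (depφ xs) (depψ xs) ⟩
      k * 0ℚ + l * 0ℚ  ≡⟨ solve 2 (λ k l → k :* con 0ℚ :+ l :* con 0ℚ := con 0ℚ) refl k l ⟩
      0ℚ ∎
      where
      open ≡-Reasoning
      open +-*-Solver

    zero-dependent : ∀ rows {φ} → (∀ x → φ x ≡ 0ℚ) → Dependent rows φ
    zero-dependent rows {φ} eq = vanish (D rows)
      where
      open +-*-Solver
      vanish : ∀ g ys → ι φ g ys ≡ 0ℚ
      vanish g []       = refl
      vanish g (y ∷ ys) rewrite eq y | vanish (g ∘ (y ∷_)) ys =
        solve 1 (λ a → con 0ℚ :* a :- con 0ℚ := con 0ℚ) refl (g ys)

    -- Expanding D along the rows exhibits z ↦ D rows (z ∷ P) as a combination of the rows.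
    contraction-dependent : ∀ R g φ xs → Dependent R φ → (∀ ys → Dependent R (λ z → g (z ∷ ys))) →
      Dependent R (λ z → ι φ g (z ∷ xs))
    contraction-dependent R g φ xs depφ dep =
      Dependent-linear R (g xs) (- 1ℚ)
        (λ z → solve 3 (λ a b c → a :* b :- c := b :* a :+ con (- 1ℚ) :* c) refl (φ z) (g xs) _)
        depφ (tail (λ z ys → g (z ∷ ys)) xs dep)
      where
      open +-*-Solver
      tail : ∀ h xs → (∀ ys → Dependent R (λ z → h z ys)) → Dependent R (λ z → ι φ (h z) xs)
      tail h []       dep = zero-dependent R (λ _ → refl)
      tail h (x ∷ xs) dep = Dependent-linear R (φ x) (- 1ℚ)
        (λ z → solve 2 (λ a b → a :- b := a :+ con (- 1ℚ) :* b) refl (φ x * h z xs) (ι φ (h z ∘ (x ∷_)) xs))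
        (dep xs) (tail (λ z ys → h z (x ∷ ys)) xs (dep ∘ (x ∷_)))

    D-dependent : ∀ R rows → (∀ {φ} → φ ∈ˡ rows → Dependent R φ) → ∀ xs → Dependent R (λ z → D rows (z ∷ xs))
    D-dependent R []         dep xs = zero-dependent R (λ _ → refl)
    D-dependent R (φ ∷ rows) dep xs =
      contraction-dependent R (D rows) φ xs (dep (here refl)) (λ ys → D-dependent R rows (dep ∘ there) ys)

    -- The quadratic Plücker relation: expanded along the added row, it is an alternating sum over
    -- the columns `y` of `ys` of products of two values of `D`, with `y` joined to `xs` in one and
    -- deleted from `ys` in the other.
    plücker : ∀ rows xs ys → ι (λ z → D rows (z ∷ xs)) (D rows) ys ≡ 0ℚ
    plücker rows xs ys = D-dependent rows rows row-dependent xs ys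

  -- Alternation in the columns, symmetric exchange and the three-term relation

  module _ {X : Set} where

    Alternating : (List X → ℚ) → Set
    Alternating g = ∀ P x y Q → g (P ++ x ∷ y ∷ Q) ≡ - g (P ++ y ∷ x ∷ Q)

    alternating-↭ : ∀ {g xs ys} → Alternating g → xs ↭ ys → g xs ≡ g ys ⊎ g xs ≡ - g ys
    alternating-↭ alt Perm.refl = inj₁ refl
    alternating-↭ alt (prep x p) = alternating-↭ (alt ∘ (x ∷_)) p
    alternating-↭ {g} {ys = _ ∷ _ ∷ ys} alt (swap x y p)
      with alternating-↭ {g ∘ (x ∷_) ∘ (y ∷_)} (λ P → alt (x ∷ y ∷ P)) p
    ... | inj₁ eq = inj₂ (trans eq (alt [] x y ys))
    ... | inj₂ eq = inj₁ (trans eq (trans (cong -_ (alt [] x y ys))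
                      (solve 1 (λ a → :- (:- a) := a) refl (g (y ∷ x ∷ ys)))))
      where open +-*-Solver
    alternating-↭ {g} {ys = zs} alt (Perm.trans p q) with alternating-↭ {g} alt p | alternating-↭ {g} alt q
    ... | inj₁ e | inj₁ f = inj₁ (trans e f)
    ... | inj₁ e | inj₂ f = inj₂ (trans e f)
    ... | inj₂ e | inj₁ f = inj₂ (trans e (cong -_ f))
    ... | inj₂ e | inj₂ f = inj₁ (trans e (trans (cong -_ f) (solve 1 (λ a → :- (:- a) := a) refl (g zs))))
      where open +-*-Solver

    -- Swapping the two leading columns swaps the two terms that evaluate φ at them; all other terms
    -- change sign with `g`.
    ι-alternating : ∀ φ {g} → Alternating g → Alternating (ι φ g)
    ι-alternating φ {g} alt [] x y Q = begin
      φ x * g (y ∷ Q) - (φ y * g (x ∷ Q) - ι φ (g ∘ (x ∷_) ∘ (y ∷_)) Q)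
        ≡⟨ cong (λ t → φ x * g (y ∷ Q) - (φ y * g (x ∷ Q) - t)) (opposite Q) ⟩
      φ x * g (y ∷ Q) - (φ y * g (x ∷ Q) - - ι φ (g ∘ (y ∷_) ∘ (x ∷_)) Q)
        ≡⟨ solve 3 (λ a b c → a :- (b :- :- c) := :- (b :- (a :- c))) refl
             (φ x * g (y ∷ Q)) (φ y * g (x ∷ Q)) (ι φ (g ∘ (y ∷_) ∘ (x ∷_)) Q) ⟩
      - (φ y * g (x ∷ Q) - (φ x * g (y ∷ Q) - ι φ (g ∘ (y ∷_) ∘ (x ∷_)) Q)) ∎
      where
      open ≡-Reasoning
      open +-*-Solver
      negate : ∀ h k → (∀ ys → h ys ≡ - k ys) → ∀ ys → ι φ h ys ≡ - ι φ k ys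
      negate h k eq []       = refl
      negate h k eq (y ∷ ys) rewrite eq ys | negate (h ∘ (y ∷_)) (k ∘ (y ∷_)) (eq ∘ (y ∷_)) ys =
        solve 3 (λ a b c → a :* :- b :- :- c := :- (a :* b :- c)) refl (φ y) (k ys) (ι φ (k ∘ (y ∷_)) ys)
      opposite = negate (g ∘ (x ∷_) ∘ (y ∷_)) (g ∘ (y ∷_) ∘ (x ∷_)) (alt [] x y)
    ι-alternating φ {g} alt (p ∷ P) x y Q
      rewrite alt P x y Q | ι-alternating φ {g ∘ (p ∷_)} (λ P′ → alt (p ∷ P′)) P x y Q =
        solve 3 (λ a b c → a :* :- b :- :- c := :- (a :* b :- c)) refl
          (φ p) (g (P ++ y ∷ x ∷ Q)) (ι φ (g ∘ (p ∷_)) (P ++ y ∷ x ∷ Q))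
      where open +-*-Solver

    D-alternating : ∀ rows → Alternating (D rows)
    D-alternating []         []      x y Q = refl
    D-alternating []         (_ ∷ _) x y Q = refl
    D-alternating (φ ∷ rows) = ι-alternating φ (D-alternating rows)

    D-↭ : ∀ rows {xs ys} → xs ↭ ys → D rows xs ≢ 0ℚ → D rows ys ≢ 0ℚ
    D-↭ rows p D≢0 D≡0 with alternating-↭ (D-alternating rows) p
    ... | inj₁ eq = D≢0 (trans eq D≡0)
    ... | inj₂ eq = D≢0 (trans eq (cong -_ D≡0))

    D-repeat : ∀ rows {x xs} → x ∈ˡ xs → D rows (x ∷ xs) ≡ 0ℚ
    D-repeat rows {x} {xs} x∈xs with D rows (x ∷ xs) ℚ.≟ 0ℚ
    ... | yes eq = eq
    ... | no neq with ∈-∃++ {A = X} x∈xs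
    ... | ys , zs , refl = contradiction
      (p≡-p⇒p≡0 (D-alternating rows [] x x (ys ++ zs)))
      (D-↭ rows (prep x (shift x ys zs)) neq)

    ι-support : ∀ (φ : X → ℚ) g xs → ι φ g xs ≢ 0ℚ →
      ∃ λ pre → ∃ λ y → ∃ λ post → xs ≡ pre ++ y ∷ post × φ y ≢ 0ℚ × g (pre ++ post) ≢ 0ℚ
    ι-support φ g []       neq = contradiction refl neq
    ι-support φ g (x ∷ xs) neq with φ x * g xs ℚ.≟ 0ℚ
    ... | yes eq = later (ι-support φ (g ∘ (x ∷_)) xs (neq ∘ cong₂ _-_ eq))
      where
      later : _ → _
      later (pre , y , post , eq , φy≢0 , g≢0) = x ∷ pre , y , post , cong (x ∷_) eq , φy≢0 , g≢0
    ... | no φx*gxs≢0 = [] , x , xs , refl ,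
      (λ eq → φx*gxs≢0 (trans (cong (_* g xs) eq) (ℚ.*-zeroˡ (g xs)))) ,
      (λ eq → φx*gxs≢0 (trans (cong (φ x *_) eq) (ℚ.*-zeroʳ (φ x))))

    -- In the Plücker relation for `W` and `x ∷ B` the leading term is the product of the two given
    -- nonzero values, so some other term is nonzero; it names the column `y` of `B` to exchange.
    D-exchange : ∀ rows {x W B} → D rows (x ∷ W) ≢ 0ℚ → D rows B ≢ 0ℚ →
      ∃ λ y → ∃ λ W′ → B ↭ y ∷ W′ × D rows (y ∷ W) ≢ 0ℚ × D rows (x ∷ W′) ≢ 0ℚ
    D-exchange rows {x} {W} {B} xW B≢0 =
      found (ι-support φ (D rows ∘ (x ∷_)) B λ eq →
        *-nonzero xW B≢0 (trans (sym (trans (cong (λ t → φ x * D rows B - t) eq)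
          (solve 1 (λ a → a :- con 0ℚ := a) refl (φ x * D rows B)))) (plücker rows W (x ∷ B))))
      where
      open +-*-Solver
      φ = λ z → D rows (z ∷ W)
      found : _ → _
      found (pre , y , post , refl , yW , xW′) = y , pre ++ post , shift y pre post , yW , xW′

    ι-vanish : ∀ (φ : X → ℚ) g xs → (∀ {x} → x ∈ˡ xs → φ x ≡ 0ℚ) → ι φ g xs ≡ 0ℚ
    ι-vanish φ g []       φ≡0 = refl
    ι-vanish φ g (x ∷ xs) φ≡0 rewrite φ≡0 (here refl) | ι-vanish φ (g ∘ (x ∷_)) xs (φ≡0 ∘ there) =
      solve 1 (λ a → con 0ℚ :* a :- con 0ℚ := con 0ℚ) refl (g xs)
      where open +-*-Solver

    -- The Plücker relation for `e₃ ∷ W` and `e₁ ∷ e₂ ∷ e₄ ∷ W` keeps only three terms, since a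
    -- column taken from `W` would occur twice next to `e₃ ∷ W`.
    three-term : ∀ rows e₁ e₂ e₃ e₄ W →
      D rows (e₁ ∷ e₃ ∷ W) * D rows (e₂ ∷ e₄ ∷ W) ≡
      D rows (e₁ ∷ e₂ ∷ W) * D rows (e₃ ∷ e₄ ∷ W) + D rows (e₁ ∷ e₄ ∷ W) * D rows (e₂ ∷ e₃ ∷ W)
    three-term rows e₁ e₂ e₃ e₄ W = begin
      p₁₃ * p₂₄
        ≡⟨ solve 6 (λ a b c d e f → a :* b := (a :* b :- (c :* d :- (:- e :* f :- con 0ℚ))) :+ (f :* e :+ d :* c))
             refl p₁₃ p₂₄ p₂₃ p₁₄ p₃₄ p₁₂ ⟩
      p₁₃ * p₂₄ - (p₂₃ * p₁₄ - (- p₃₄ * p₁₂ - 0ℚ)) + rhs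
        ≡⟨ cong (λ t → p₁₃ * p₂₄ - (p₂₃ * p₁₄ - (t * p₁₂ - 0ℚ)) + rhs) p₄₃ ⟨
      p₁₃ * p₂₄ - (p₂₃ * p₁₄ - (D rows (e₄ ∷ e₃ ∷ W) * p₁₂ - 0ℚ)) + rhs
        ≡⟨ cong (λ t → p₁₃ * p₂₄ - (p₂₃ * p₁₄ - (D rows (e₄ ∷ e₃ ∷ W) * p₁₂ - t)) + rhs) tail≡0 ⟨
      ι φ (D rows) (e₁ ∷ e₂ ∷ e₄ ∷ W) + rhs
        ≡⟨ cong (_+ rhs) (plücker rows (e₃ ∷ W) (e₁ ∷ e₂ ∷ e₄ ∷ W)) ⟩
      0ℚ + rhs
        ≡⟨ ℚ.+-identityˡ rhs ⟩
      rhs ∎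
      where
      open ≡-Reasoning
      open +-*-Solver
      φ = λ z → D rows (z ∷ e₃ ∷ W)
      p₁₂ = D rows (e₁ ∷ e₂ ∷ W)
      p₁₃ = D rows (e₁ ∷ e₃ ∷ W)
      p₁₄ = D rows (e₁ ∷ e₄ ∷ W)
      p₂₃ = D rows (e₂ ∷ e₃ ∷ W)
      p₂₄ = D rows (e₂ ∷ e₄ ∷ W)
      p₃₄ = D rows (e₃ ∷ e₄ ∷ W)
      p₄₃ : D rows (e₄ ∷ e₃ ∷ W) ≡ - p₃₄
      p₄₃ = D-alternating rows [] e₄ e₃ W
      rhs = p₁₂ * p₃₄ + p₁₄ * p₂₃
      tail≡0 : ι φ (D rows ∘ (e₁ ∷_) ∘ (e₂ ∷_) ∘ (e₄ ∷_)) W ≡ 0ℚ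
      tail≡0 = ι-vanish φ (D rows ∘ (e₁ ∷_) ∘ (e₂ ∷_) ∘ (e₄ ∷_)) W (λ w∈W → D-repeat rows (there w∈W))

    -- The nested subtractions of `ι` unfold to the signs `sgn`, and `c ∘ punchIn j` is `c` with
    -- column `j` deleted.
    laplace : ∀ k (φ : X → ℚ) g (c : Fin (suc k) → X) →
      sumQ (λ j → sgn (toℕ j) * (φ (c j) * g (tabulate (c ∘ punchIn j)))) ≡ ι φ g (tabulate c)
    laplace zero φ g c = solve 1 (λ a → con 1ℚ :* a :+ con 0ℚ := a :- con 0ℚ) refl (φ (c zero) * g [])
      where open +-*-Solver
    laplace (suc k) φ g c = begin
      1ℚ * (φ (c zero) * g (tabulate (c ∘ suc))) + sumQ (λ j → - sgn (toℕ j) * t j)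
        ≡⟨ cong (1ℚ * (φ (c zero) * g (tabulate (c ∘ suc))) +_) (negate (sgn ∘ toℕ) t) ⟩
      1ℚ * (φ (c zero) * g (tabulate (c ∘ suc))) + - sumQ (λ j → sgn (toℕ j) * t j)
        ≡⟨ cong₂ (λ a b → a + - b) (ℚ.*-identityˡ (φ (c zero) * g (tabulate (c ∘ suc))))
             (laplace k φ (g ∘ (c zero ∷_)) (c ∘ suc)) ⟩
      φ (c zero) * g (tabulate (c ∘ suc)) - ι φ (g ∘ (c zero ∷_)) (tabulate (c ∘ suc)) ∎
      where
      open ≡-Reasoning
      open +-*-Solver
      t = λ (j : Fin (suc k)) → φ (c (suc j)) * g (c zero ∷ tabulate (c ∘ suc ∘ punchIn j))
      negate : ∀ {m} (f h : Fin m → ℚ) → sumQ (λ j → - f j * h j) ≡ - sumQ (λ j → f j * h j)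
      negate {zero}  f h = refl
      negate {suc m} f h rewrite negate (f ∘ suc) (h ∘ suc) =
        solve 3 (λ a b c → :- a :* b :+ :- c := :- (a :* b :+ c)) refl (f zero) (h zero) _

    sumQ-cong : ∀ {m} {f g : Fin m → ℚ} → (∀ i → f i ≡ g i) → sumQ f ≡ sumQ g
    sumQ-cong {zero}  eq = refl
    sumQ-cong {suc m} eq = cong₂ _+_ (eq zero) (sumQ-cong (eq ∘ suc))

    det≡D : ∀ k (rows : Fin k → X → ℚ) (c : Fin k → X) →
      det k (λ i j → rows i (c j)) ≡ D (tabulate rows) (tabulate c)
    det≡D zero    rows c = refl
    det≡D (suc k) rows c = trans
      (sumQ-cong (λ j → cong (λ t → sgn (toℕ j) * (rows zero (c j) * t)) (det≡D k (rows ∘ suc) (c ∘ punchIn j))))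
      (laplace k (rows zero) (D (tabulate (rows ∘ suc))) c)

  tabulate-lookup : ∀ {X : Set} {k} (v : Vec X k) → tabulate (lookup v) ≡ Vec.toList v
  tabulate-lookup []      = refl
  tabulate-lookup (x ∷ v) = cong (x ∷_) (tabulate-lookup v)

  minor≡D : ∀ {d n} (A : Matrix d n) c → minor A c ≡ D (tabulate A) (Vec.toList c)
  minor≡D {d} A c = trans (det≡D d A (lookup c)) (cong (D (tabulate A)) (tabulate-lookup c))

  module _ {X : Set} where

    symmetric-↭ : ∀ {h : List X → ℚ} {xs ys} → (∀ P x y Q → h (P ++ x ∷ y ∷ Q) ≡ h (P ++ y ∷ x ∷ Q)) →
      xs ↭ ys → h xs ≡ h ys
    symmetric-↭ h-sym Perm.refl = refl
    symmetric-↭ h-sym (prep x p) = symmetric-↭ (h-sym ∘ (x ∷_)) p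
    symmetric-↭ {h} {ys = _ ∷ _ ∷ ys} h-sym (swap x y p) =
      trans (symmetric-↭ {h ∘ (x ∷_) ∘ (y ∷_)} (λ P → h-sym (x ∷ y ∷ P)) p) (h-sym [] x y ys)
    symmetric-↭ {h} h-sym (Perm.trans p q) = trans (symmetric-↭ {h} h-sym p) (symmetric-↭ {h} h-sym q)

    ⊆⇒∈combs : ∀ {k m} (v : Vec X k) (w : Vec X m) → Vec.toList v ⊆ Vec.toList w → v ∈ˡ combs k w
    ⊆⇒∈combs []      w        _          = here refl
    ⊆⇒∈combs (x ∷ v) (y ∷ w) (_ ∷ʳ p)   = ∈-++⁺ʳ _ (⊆⇒∈combs (x ∷ v) w p)
    ⊆⇒∈combs (x ∷ v) (y ∷ w) (refl ∷ p) = ∈-++⁺ˡ (∈-map⁺ (x ∷_) (⊆⇒∈combs v w p))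

    toList-surjective : ∀ {k} (xs : List X) → length xs ≡ k → ∃ λ (v : Vec X k) → Vec.toList v ≡ xs
    toList-surjective []       refl = [] , refl
    toList-surjective (x ∷ xs) refl with toList-surjective xs refl
    ... | v , eq = x ∷ v , cong (x ∷_) eq

    toList-tabulate : ∀ {k} (f : Fin k → X) → Vec.toList (Vec.tabulate f) ≡ tabulate f
    toList-tabulate {zero}  f = refl
    toList-tabulate {suc k} f = cong (f zero ∷_) (toList-tabulate (f ∘ suc))

    D-length : ∀ (rows : List (X → ℚ)) {xs} → D rows xs ≢ 0ℚ → length xs ≡ length rows
    D-length []         {[]}     neq = refl
    D-length []         {x ∷ xs} neq = contradiction refl neq
    D-length (φ ∷ rows) {xs}     neq with ι-support φ (D rows) xs neq
    ... | pre , y , post , refl , _ , g≢0 = trans (↭-length (shift y pre post)) (cong suc (D-length rows g≢0))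

    D-unique : ∀ (rows : List (X → ℚ)) {xs} → D rows xs ≢ 0ℚ → Unique xs
    D-unique rows {xs} = suffix [] xs
      where
      -- `P` holds the columns already passed. Each further column is moved in front of `P`, where a
      -- repetition makes `D` vanish.
      suffix : ∀ P xs → D rows (P ++ xs) ≢ 0ℚ → Unique xs
      suffix P []       neq = []
      suffix P (x ∷ xs) neq =
        All.tabulate (λ {y} y∈xs x≡y → D-↭ rows (shift x P xs) neq
          (D-repeat rows (∈-++⁺ʳ P (subst (_∈ˡ xs) (sym x≡y) y∈xs)))) ∷
        suffix (P ++ x ∷ []) xs (subst (λ zs → D rows zs ≢ 0ℚ) (sym (List.++-assoc P (x ∷ []) xs)) neq)

  -- Signs of sorting permutations, built from the sign of j - i for each pair

  orientation : ℕ → ℕ → ℚ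
  orientation zero    zero    = 0ℚ
  orientation zero    (suc j) = 1ℚ
  orientation (suc i) zero    = - 1ℚ
  orientation (suc i) (suc j) = orientation i j

  orientation-antisym : ∀ i j → orientation i j ≡ - orientation j i
  orientation-antisym zero    zero    = refl
  orientation-antisym zero    (suc j) = refl
  orientation-antisym (suc i) zero    = refl
  orientation-antisym (suc i) (suc j) = orientation-antisym i j

  orientation-< : ∀ {i j} → i ℕ.< j → orientation i j ≡ 1ℚ
  orientation-< {zero}  {suc j} _           = refl
  orientation-< {suc i} {suc j} (ℕ.s≤s i<j) = orientation-< i<j

  orientation-≢ : ∀ {i j} → i ≢ j → orientation i j ≢ 0ℚ
  orientation-≢ {zero}  {zero}  i≢j = contradiction refl i≢j
  orientation-≢ {zero}  {suc j} i≢j = λ ()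
  orientation-≢ {suc i} {zero}  i≢j = λ ()
  orientation-≢ {suc i} {suc j} i≢j = orientation-≢ (i≢j ∘ cong suc)

  module _ {n : ℕ} where

    signAgainst : Fin n → List (Fin n) → ℚ
    signAgainst x []       = 1ℚ
    signAgainst x (y ∷ ys) = orientation (toℕ x) (toℕ y) * signAgainst x ys

    -- The sign of the permutation sorting a list, 0 in the presence of repetitions.
    ε : List (Fin n) → ℚ
    ε []       = 1ℚ
    ε (x ∷ xs) = signAgainst x xs * ε xs

    signAgainst-swap : ∀ p P x y Q → signAgainst p (P ++ x ∷ y ∷ Q) ≡ signAgainst p (P ++ y ∷ x ∷ Q)
    signAgainst-swap p []      x y Q =
      solve 3 (λ a b c → a :* (b :* c) := b :* (a :* c)) refl
        (orientation (toℕ p) (toℕ x)) (orientation (toℕ p) (toℕ y)) (signAgainst p Q)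
      where open +-*-Solver
    signAgainst-swap p (z ∷ P) x y Q = cong (orientation (toℕ p) (toℕ z) *_) (signAgainst-swap p P x y Q)

    ε-alternating : Alternating ε
    ε-alternating [] x y Q rewrite orientation-antisym (toℕ x) (toℕ y) =
      solve 4 (λ a b c d → (:- a :* b) :* (c :* d) := :- ((a :* c) :* (b :* d))) refl
        (orientation (toℕ y) (toℕ x)) (signAgainst x Q) (signAgainst y Q) (ε Q)
      where open +-*-Solver
    ε-alternating (p ∷ P) x y Q rewrite ε-alternating P x y Q | signAgainst-swap p P x y Q =
      solve 2 (λ a b → a :* :- b := :- (a :* b)) refl (signAgainst p (P ++ y ∷ x ∷ Q)) (ε (P ++ y ∷ x ∷ Q))
      where open +-*-Solver

    ε-sorted : ∀ {xs} → AllPairs Fin._<_ xs → ε xs ≡ 1ℚ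
    ε-sorted []         = refl
    ε-sorted (x< ∷ xs!) = cong₂ _*_ (signAgainst-below x<) (ε-sorted xs!)
      where
      signAgainst-below : ∀ {x xs} → All (x Fin.<_) xs → signAgainst x xs ≡ 1ℚ
      signAgainst-below []         = refl
      signAgainst-below (x<y ∷ x<) = cong₂ _*_ (orientation-< x<y) (signAgainst-below x<)

    ε-unique : ∀ {xs} → Unique xs → ε xs ≢ 0ℚ
    ε-unique []        = λ ()
    ε-unique (x∉ ∷ xs!) = *-nonzero (signAgainst-≢ x∉) (ε-unique xs!)
      where
      signAgainst-≢ : ∀ {x xs} → All (x ≢_) xs → signAgainst x xs ≢ 0ℚ
      signAgainst-≢ []         = λ ()
      signAgainst-≢ (x≢y ∷ x∉) = *-nonzero (orientation-≢ (x≢y ∘ Fin.toℕ-injective)) (signAgainst-≢ x∉)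

    module _ {c : List (Fin n)} (c! : Unique c) where
      open DecMembership (Fin._≟_ {n}) using (_∈?_)

      -- `dSubsets` lists every subset in increasing order only, so total nonnegativity applies to
      -- `c` only through this rearrangement.
      sorted : List (Fin n)
      sorted = filter (_∈? c) (List.allFin n)

      sorted-↭ : sorted ↭ c
      sorted-↭ = ∼bag⇒↭ (unique∧set⇒bag (Unique.filter⁺ (_∈? c) (Unique.allFin⁺ n)) c!
        (mk⇔ (proj₂ ∘ ∈-filter⁻ (_∈? c) {xs = List.allFin n}) (∈-filter⁺ (_∈? c) (∈-allFin _))))

      sorted-< : AllPairs Fin._<_ sorted
      sorted-< = AllPairs.filter⁺ (_∈? c) (AllPairs.tabulate⁺-< (λ i<j → i<j))

      sorted∈dSubsets : ∀ {d} → length c ≡ d → ∃ λ v → v ∈ˡ dSubsets d n × Vec.toList v ≡ sorted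
      sorted∈dSubsets len with toList-surjective sorted (trans (↭-length sorted-↭) len)
      ... | v , eq = v , ⊆⇒∈combs v (Vec.allFin n)
        (subst₂ _⊆_ (sym eq) (sym (toList-tabulate (λ i → i))) (filter-⊆ (_∈? c) (List.allFin n))) , eq

  -- The positroid of a totally nonnegative matrix

  module Positroid {d n : ℕ} (A : Matrix d n) where

    rows : List (Fin n → ℚ)
    rows = tabulate A

    IsBasis : List (Fin n) → Set
    IsBasis c = D rows c ≢ 0ℚ

    IsBasis-∉ : ∀ {x xs} → IsBasis (x ∷ xs) → x ∉ˡ xs
    IsBasis-∉ b x∈xs = b (D-repeat rows x∈xs)

    IsBasis-length : ∀ {c} → IsBasis c → length c ≡ d
    IsBasis-length b = trans (D-length rows b) (List.length-tabulate A)

    bases⁺ : ∀ {c} → IsBasis c → ∃ λ v → v ∈ˡ bases A × Vec.toList v ↭ c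
    bases⁺ {c} b with sorted∈dSubsets (D-unique rows b) (IsBasis-length b)
    ... | v , v∈ , eq = v ,
      ∈-filter⁺ (λ c → ¬? (minor A c ℚ.≟ 0ℚ)) v∈
        (λ minor≡0 → D-↭ rows (↭-sym v↭c) b (trans (sym (minor≡D A v)) minor≡0)) , v↭c
      where v↭c = ↭-trans (↭-reflexive eq) (sorted-↭ (D-unique rows b))

    bases⁻ : ∀ {v} → v ∈ˡ bases A → IsBasis (Vec.toList v)
    bases⁻ {v} v∈ D≡0 = proj₂ (∈-filter⁻ (λ c → ¬? (minor A c ℚ.≟ 0ℚ)) {xs = dSubsets d n} v∈) (trans (minor≡D A v) D≡0)

    module _ (tnn : TotallyNonneg A) where

      -- Both factors change sign when adjacent columns are swapped, so the product is independent
      -- of their order; on the increasing list `ε` is 1 and `D` is a minor of `A`.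
      εD-nonneg : ∀ c → 0ℚ ℚ.≤ ε c * D rows c
      εD-nonneg c with D rows c ℚ.≟ 0ℚ
      ... | yes D≡0 = ℚ.≤-reflexive (sym (trans (cong (ε c *_) D≡0) (ℚ.*-zeroʳ (ε c))))
      ... | no  b with sorted∈dSubsets (D-unique rows b) (IsBasis-length b)
      ... | v , v∈ , eq = subst (0ℚ ℚ.≤_) (begin
        minor A v                         ≡⟨ minor≡D A v ⟩
        D rows (Vec.toList v)             ≡⟨ cong (D rows) eq ⟩
        D rows c′                         ≡⟨ ℚ.*-identityˡ (D rows c′) ⟨
        1ℚ * D rows c′                    ≡⟨ cong (_* D rows c′) (ε-sorted (sorted-< c!)) ⟨
        ε c′ * D rows c′                  ≡⟨ symmetric-↭ {h = λ xs → ε xs * D rows xs} εD-symmetric (sorted-↭ c!) ⟩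
        ε c * D rows c                    ∎)
        (All.lookup tnn v∈)
        where
        open ≡-Reasoning
        c! = D-unique rows b
        c′ = sorted c!
        εD-symmetric : ∀ P x y Q →
          ε (P ++ x ∷ y ∷ Q) * D rows (P ++ x ∷ y ∷ Q) ≡ ε (P ++ y ∷ x ∷ Q) * D rows (P ++ y ∷ x ∷ Q)
        εD-symmetric P x y Q rewrite ε-alternating P x y Q | D-alternating rows P x y Q =
          solve 2 (λ a b → :- a :* :- b := a :* b) refl (ε (P ++ y ∷ x ∷ Q)) (D rows (P ++ y ∷ x ∷ Q))
          where open +-*-Solver

      εD-positive : ∀ {c} → IsBasis c → 0ℚ ℚ.< ε c * D rows c
      εD-positive {c} b = ℚ.positive⁻¹ _ {{ℚ.nonNeg∧nonZero⇒pos (ε c * D rows c)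
        {{ℚ.nonNegative (εD-nonneg c)}} {{ℚ.≢-nonZero (*-nonzero (ε-unique (D-unique rows b)) b)}}}}

      -- Up to the sign of the columns W, all terms of the three-term relation are positive.
      diagonal : ∀ {e₁ e₂ e₃ e₄ W} → e₁ Fin.< e₂ → e₂ Fin.< e₃ → e₃ Fin.< e₄ →
        IsBasis (e₁ ∷ e₂ ∷ W) → IsBasis (e₂ ∷ e₃ ∷ W) → IsBasis (e₃ ∷ e₄ ∷ W) → IsBasis (e₁ ∷ e₄ ∷ W) →
        IsBasis (e₁ ∷ e₃ ∷ W) × IsBasis (e₂ ∷ e₄ ∷ W)
      diagonal {e₁} {e₂} {e₃} {e₄} {W} l₁₂ l₂₃ l₃₄ b₁₂ b₂₃ b₃₄ b₁₄ =
        (λ eq → ℚ.<-irrefl refl (subst (0ℚ ℚ.<_)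
          (trans (cong (λ t → ε (e₁ ∷ e₃ ∷ W) * t * (ε (e₂ ∷ e₄ ∷ W) * D rows (e₂ ∷ e₄ ∷ W))) eq)
            (solve 3 (λ a b c → a :* con 0ℚ :* (b :* c) := con 0ℚ) refl
               (ε (e₁ ∷ e₃ ∷ W)) (ε (e₂ ∷ e₄ ∷ W)) (D rows (e₂ ∷ e₄ ∷ W)))) positive)) ,
        (λ eq → ℚ.<-irrefl refl (subst (0ℚ ℚ.<_)
          (trans (cong (λ t → ε (e₁ ∷ e₃ ∷ W) * D rows (e₁ ∷ e₃ ∷ W) * (ε (e₂ ∷ e₄ ∷ W) * t)) eq)
            (solve 3 (λ a b c → a :* c :* (b :* con 0ℚ) := con 0ℚ) refl
               (ε (e₁ ∷ e₃ ∷ W)) (ε (e₂ ∷ e₄ ∷ W)) (D rows (e₁ ∷ e₃ ∷ W)))) positive))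
        where
        open +-*-Solver
        εD = λ c → ε c * D rows c
        ε-pair : ∀ {x y} → x Fin.< y → ε (x ∷ y ∷ W) ≡ signAgainst x W * (signAgainst y W * ε W)
        ε-pair {x} {y} x<y = cong (_* (signAgainst y W * ε W))
          (trans (cong (_* signAgainst x W) (orientation-< x<y)) (ℚ.*-identityˡ (signAgainst x W)))
        l₁₃ = Fin.<-trans l₁₂ l₂₃
        l₂₄ = Fin.<-trans l₂₃ l₃₄
        l₁₄ = Fin.<-trans l₁₃ l₃₄
        -- Since each pair is increasing, all three products of signs equal s₁ s₂ s₃ s₄ w², and the
        -- relation keeps its plus sign.
        relation : εD (e₁ ∷ e₃ ∷ W) * εD (e₂ ∷ e₄ ∷ W) ≡
          εD (e₁ ∷ e₂ ∷ W) * εD (e₃ ∷ e₄ ∷ W) + εD (e₁ ∷ e₄ ∷ W) * εD (e₂ ∷ e₃ ∷ W)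
        relation rewrite ε-pair l₁₂ | ε-pair l₂₃ | ε-pair l₃₄ | ε-pair l₁₃ | ε-pair l₂₄ | ε-pair l₁₄ =
          trans (solve 7 (λ a b c d w p q → (a :* (c :* w) :* p) :* (b :* (d :* w) :* q)
                             := a :* b :* c :* d :* w :* w :* (p :* q)) refl
                   s₁ s₂ s₃ s₄ w (p e₁ e₃) (p e₂ e₄))
          (trans (cong (s₁ * s₂ * s₃ * s₄ * w * w *_) (three-term rows e₁ e₂ e₃ e₄ W))
            (solve 9 (λ a b c d w p q r s → a :* b :* c :* d :* w :* w :* (p :* q :+ r :* s)
               := (a :* (b :* w) :* p) :* (c :* (d :* w) :* q) :+ (a :* (d :* w) :* r) :* (b :* (c :* w) :* s)) refl
               s₁ s₂ s₃ s₄ w (p e₁ e₂) (p e₃ e₄) (p e₁ e₄) (p e₂ e₃)))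
          where
          s₁ = signAgainst e₁ W
          s₂ = signAgainst e₂ W
          s₃ = signAgainst e₃ W
          s₄ = signAgainst e₄ W
          w  = ε W
          p  = λ x y → D rows (x ∷ y ∷ W)
        product-positive : ∀ {p q} → 0ℚ ℚ.< p → 0ℚ ℚ.< q → 0ℚ ℚ.< p * q
        product-positive {p} {q} 0<p 0<q =
          ℚ.positive⁻¹ (p * q) {{ℚ.pos*pos⇒pos p {{ℚ.positive 0<p}} q {{ℚ.positive 0<q}}}}
        positive : 0ℚ ℚ.< εD (e₁ ∷ e₃ ∷ W) * εD (e₂ ∷ e₄ ∷ W)
        positive = subst (0ℚ ℚ.<_) (sym relation) (ℚ.+-mono-<
          (product-positive (εD-positive b₁₂) (εD-positive b₃₄))
          (product-positive (εD-positive b₁₄) (εD-positive b₂₃)))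

open Minors
open import Data.Nat using (_+_; _∸_; _<_; _≤ᵇ_; z≤n; s≤s)

-- Basis exchange

χ : Bool → ℕ
χ b = if b then 1 else 0

module _ {X : Set} where

  count : (X → Bool) → List X → ℕ
  count S []       = 0
  count S (x ∷ xs) = χ (S x) + count S xs

  count-++ : ∀ S xs ys → count S (xs ++ ys) ≡ count S xs + count S ys
  count-++ S []       ys = refl
  count-++ S (x ∷ xs) ys = trans (cong (χ (S x) +_) (count-++ S xs ys)) (sym (ℕ.+-assoc (χ (S x)) _ _))

  count-↭ : ∀ S {xs ys} → xs ↭ ys → count S xs ≡ count S ys
  count-↭ S Perm.refl        = refl
  count-↭ S (prep x p)       = cong (χ (S x) +_) (count-↭ S p)
  count-↭ S {_ ∷ _ ∷ xs} {_ ∷ _ ∷ ys} (swap x y p) = begin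
    χ (S x) + (χ (S y) + count S xs) ≡⟨ ℕ.+-assoc (χ (S x)) _ _ ⟨
    χ (S x) + χ (S y) + count S xs   ≡⟨ cong₂ _+_ (ℕ.+-comm (χ (S x)) _) (count-↭ S p) ⟩
    χ (S y) + χ (S x) + count S ys   ≡⟨ ℕ.+-assoc (χ (S y)) _ _ ⟩
    χ (S y) + (χ (S x) + count S ys) ∎
    where open ≡-Reasoning
  count-↭ S (Perm.trans p q) = trans (count-↭ S p) (count-↭ S q)

  count-none : ∀ S {xs} → All (λ x → S x ≡ false) xs → count S xs ≡ 0
  count-none S []         = refl
  count-none S (eq ∷ eqs) rewrite eq = count-none S eqs

  count≡0⇒none : ∀ S xs → count S xs ≡ 0 → All (λ x → S x ≡ false) xs
  count≡0⇒none S []       eq = []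
  count≡0⇒none S (x ∷ xs) eq with S x in Sx
  ... | false = Sx ∷ count≡0⇒none S xs eq

  separate : ∀ (S : X → Bool) xs → ∃ λ Q → ∃ λ R →
    xs ↭ Q ++ R × All (λ x → S x ≡ true) Q × All (λ x → S x ≡ false) R
  separate S []       = [] , [] , ↭-refl , [] , []
  separate S (x ∷ xs) with separate S xs | S x in Sx
  ... | Q , R , p , q , r | true  = x ∷ Q , R , prep x p , Sx ∷ q , r
  ... | Q , R , p , q , r | false =
    Q , x ∷ R , ↭-trans (prep x p) (↭-sym (shift x Q R)) , q , Sx ∷ r

module BasisExchange {X : Set} (IsBasis : List X → Set)
  (IsBasis-↭ : ∀ {xs ys} → xs ↭ ys → IsBasis xs → IsBasis ys)
  (IsBasis-∉ : ∀ {x xs} → IsBasis (x ∷ xs) → x ∉ˡ xs)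
  (exchange : ∀ {x W B} → IsBasis (x ∷ W) → IsBasis B →
    ∃ λ y → ∃ λ V → B ↭ y ∷ V × IsBasis (y ∷ W) × IsBasis (x ∷ V))
  where

  -- Exchanges the elements todo of the basis C one at a time into a second basis,
  -- maintaining an invariant P of the latter, unless some step lands in Stop.
  transfer : ∀ {S : X → Set} {Stop : Set} (P : List X → Set) {C R} →
    (∀ {xs ys} → xs ↭ ys → P xs → P ys) →
    (∀ {x y W V} → S x → x ∷ W ↭ C → IsBasis (y ∷ W) → IsBasis (x ∷ V) → P (y ∷ V) → Stop ⊎ P (x ∷ V)) →
    IsBasis C → ∀ todo done V → C ↭ todo ++ done ++ R → All S todo →
    IsBasis (done ++ V) → P (done ++ V) →
    Stop ⊎ ∃ λ V′ → IsBasis (todo ++ done ++ V′) × P (todo ++ done ++ V′)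
  transfer P P-↭ step bC []         done V C↭ S b p = inj₂ (V , b , p)
  transfer P {C} {R} P-↭ step bC (x ∷ todo) done V C↭ (Sx ∷ S) b p with exchange (IsBasis-↭ C↭ bC) b
  ... | y , U , ↭yU , yW , xU with ∈-++⁻ done (∈-resp-↭ (↭-sym ↭yU) (here refl))
  ... | inj₁ y∈done = contradiction (∈-++⁺ʳ todo (∈-++⁺ˡ y∈done)) (IsBasis-∉ yW)
  ... | inj₂ y∈V with ∈-∃++ y∈V
  ... | V₁ , V₂ , refl
    with step Sx (↭-sym C↭) yW xU (P-↭ ↭yU p)
  ... | inj₁ stop = inj₁ stop
  ... | inj₂ p′
    with transfer P P-↭ step bC todo (x ∷ done) (V₁ ++ V₂)
           (↭-trans C↭ (↭-sym (shift x todo (done ++ R)))) S (IsBasis-↭ xU↭ xU) (P-↭ xU↭ p′)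
    where
    U↭ : U ↭ done ++ V₁ ++ V₂
    U↭ = drop-mid [] [] (↭-trans (↭-sym ↭yU) (↭-trans (++⁺ˡ done (shift y V₁ V₂)) (shift y done (V₁ ++ V₂))))
    xU↭ : x ∷ U ↭ x ∷ done ++ V₁ ++ V₂
    xU↭ = prep x U↭
  ... | inj₁ stop = inj₁ stop
  ... | inj₂ (V′ , b′ , q) = inj₂ (V′ , IsBasis-↭ (shift x todo _) b′ , P-↭ (shift x todo _) q)

  transfer-all : ∀ {S : X → Set} (P : List X → Set) {C} Q R {B} →
    (∀ {xs ys} → xs ↭ ys → P xs → P ys) →
    (∀ {x y W V} → S x → x ∷ W ↭ C → IsBasis (y ∷ W) → IsBasis (x ∷ V) → P (y ∷ V) → P (x ∷ V)) →
    IsBasis C → C ↭ Q ++ R → All S Q → IsBasis B → P B → ∃ λ V → IsBasis (Q ++ V) × P (Q ++ V)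
  transfer-all P Q R {B} P-↭ step bC C↭ q bB p
    with transfer {Stop = ⊥} P P-↭ (λ s p yW xV q → inj₂ (step s p yW xV q)) bC Q [] B C↭ q bB p
  ... | inj₂ result = result

  -- The optimal bases are those of M|E ⊕ M/E.
  module Optimal (E : X → Bool) (r : ℕ) (maximal : ∀ {B} → IsBasis B → count E B ≤ r) where

    IsOptimal : List X → Set
    IsOptimal B = IsBasis B × count E B ≡ r

    IsOptimal-↭ : ∀ {xs ys} → xs ↭ ys → IsOptimal xs → IsOptimal ys
    IsOptimal-↭ p (b , c) = IsBasis-↭ p b , trans (sym (count-↭ E p)) c

    -- Otherwise one of the new bases has r + 1 elements in `E`: `x ∷ V` if only `x` lies in `E`,
    -- and `y ∷ W` if only `y` does.
    exchange-class : ∀ {x y W V} → count E (x ∷ W) ≡ r → IsBasis (y ∷ W) → IsBasis (x ∷ V) →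
      count E (y ∷ V) ≡ r → E x ≡ E y
    exchange-class {x} {y} xW yW xV yV with E x | E y | maximal yW | maximal xV
    ... | true  | true  | _ | _ = refl
    ... | false | false | _ | _ = refl
    ... | true  | false | _ | le = contradiction (subst (λ t → suc t ≤ r) yV le) (ℕ.<-irrefl refl)
    ... | false | true  | le | _ = contradiction (subst (λ t → suc t ≤ r) xW le) (ℕ.<-irrefl refl)

    exchange-optimal : ∀ {x y V} → E x ≡ E y → IsBasis (x ∷ V) → count E (y ∷ V) ≡ r → IsOptimal (x ∷ V)
    exchange-optimal {V = V} Ex≡Ey xV yV = xV , trans (cong (λ b → χ b + count E V) Ex≡Ey) yV

    -- An exchange between optimal bases that leaves `S`. The equal values of `E` record that it
    -- stays within `E` or within the complement of `E`.
    Crossing : (X → Bool) → Set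
    Crossing S = ∃ λ x → ∃ λ y → ∃ λ W → S x ≡ true × S y ≡ false × E x ≡ E y ×
      IsOptimal (x ∷ W) × IsOptimal (y ∷ W)

    -- The elements of `B` in `S` are transferred into `C`. If each of them replaced an element of
    -- `S`, the count on `S` would stay that of `C`, although the final basis contains all of `B` in
    -- `S`.
    nonconstant⇒crossing : ∀ S {B C} → IsOptimal B → IsOptimal C → count S C < count S B → Crossing S
    nonconstant⇒crossing S {B} {C} (bB , eB) (bC , eC) lt with separate S B
    ... | Q , R , B↭ , q , r≡
      with transfer (λ xs → count E xs ≡ r × count S xs ≡ count S C)
             (λ p (e , f) → trans (sym (count-↭ E p)) e , trans (sym (count-↭ S p)) f)
             step bB Q [] C B↭ q bC (eC , refl)
      where
      step : ∀ {x y W V} → S x ≡ true → x ∷ W ↭ B → IsBasis (y ∷ W) → IsBasis (x ∷ V) →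
        count E (y ∷ V) ≡ r × count S (y ∷ V) ≡ count S C →
        Crossing S ⊎ (count E (x ∷ V) ≡ r × count S (x ∷ V) ≡ count S C)
      step {x} {y} {W} {V} Sx ↭B yW xV (e , f) = by-class (S y) refl
        where
        eW : count E (x ∷ W) ≡ r
        eW = trans (count-↭ E ↭B) eB
        Ex≡Ey : E x ≡ E y
        Ex≡Ey = exchange-class eW yW xV e
        by-class : ∀ b → S y ≡ b → Crossing S ⊎ (count E (x ∷ V) ≡ r × count S (x ∷ V) ≡ count S C)
        by-class true  Sy = inj₂ (proj₂ (exchange-optimal Ex≡Ey xV e) ,
          trans (cong (λ b → χ b + count S V) (trans Sx (sym Sy))) f)
        -- `x ∷ W` is `B` up to order, so the crossing is found at `B` itself and not at the basis
        -- under construction.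
        by-class false Sy = inj₁ (x , y , W , Sx , Sy , Ex≡Ey ,
          IsOptimal-↭ (↭-sym ↭B) (bB , eB) , exchange-optimal (sym Ex≡Ey) yW eW)
    ... | inj₁ stop = stop
    ... | inj₂ (V , _ , _ , eq) = contradiction
      (begin-strict
        count S C           <⟨ lt ⟩
        count S B           ≡⟨ count-↭ S B↭ ⟩
        count S (Q ++ R)    ≡⟨ count-++ S Q R ⟩
        count S Q + count S R ≡⟨ cong (count S Q +_) (count-none S r≡) ⟩
        count S Q + 0       ≤⟨ ℕ.+-monoʳ-≤ (count S Q) z≤n ⟩
        count S Q + count S V ≡⟨ count-++ S Q V ⟨
        count S (Q ++ V)    ≡⟨ eq ⟩
        count S C           ∎)
      (ℕ.<-irrefl refl)
      where open ℕ.≤-Reasoning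

    -- The elements of `B` in `S` are transferred into `C`. Each incoming element lies in `E`, so
    -- the count on `E` cannot fall below `r`.
    extend-max : ∀ S {B C} → (∀ {x} → S x ≡ true → E x ≡ true) → IsBasis B → IsOptimal C →
      ∃ λ B′ → IsOptimal B′ × count S B ≤ count S B′
    extend-max S {B} {C} S⊆E bB (bC , eC) with separate S B
    ... | Q , R , B↭ , q , r≡
      with transfer-all (λ xs → r ≤ count E xs) Q R (λ p → subst (r ≤_) (count-↭ E p))
             step bB B↭ q bC (ℕ.≤-reflexive (sym eC))
      where
      step : ∀ {x y W V} → S x ≡ true → x ∷ W ↭ B → IsBasis (y ∷ W) → IsBasis (x ∷ V) →
        r ≤ count E (y ∷ V) → r ≤ count E (x ∷ V)
      step {x} {y} {W} {V} Sx _ _ _ le rewrite S⊆E Sx = ℕ.≤-trans le (ℕ.+-monoˡ-≤ (count E V) (χ≤1 (E y)))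
        where
        χ≤1 : ∀ b → χ b ≤ 1
        χ≤1 true  = s≤s z≤n
        χ≤1 false = z≤n
    ... | V , b , le = Q ++ V , (b , ℕ.≤-antisym (maximal b) le) , (begin
        count S B             ≡⟨ count-↭ S B↭ ⟩
        count S (Q ++ R)      ≡⟨ count-++ S Q R ⟩
        count S Q + count S R ≡⟨ cong (count S Q +_) (count-none S r≡) ⟩
        count S Q + 0         ≤⟨ ℕ.+-monoʳ-≤ (count S Q) z≤n ⟩
        count S Q + count S V ≡⟨ count-++ S Q V ⟨
        count S (Q ++ V)      ∎)
      where open ℕ.≤-Reasoning

    -- The elements of `C` in `E` are transferred into `B`. They avoid `G`, so the count on `G` can
    -- only fall, and once all are present the basis is optimal.
    extend-min : ∀ G {B C} → (∀ {x} → E x ≡ true → G x ≡ false) → IsBasis B → IsOptimal C →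
      ∃ λ B′ → IsOptimal B′ × count G B′ ≤ count G B
    extend-min G {B} {C} E∩G bB (bC , eC) with separate E C
    ... | Q , R , C↭ , q , r≡
      with transfer-all (λ xs → count G xs ≤ count G B) Q R (λ p → subst (_≤ count G B) (count-↭ G p))
             step bC C↭ q bB ℕ.≤-refl
      where
      step : ∀ {x y W V} → E x ≡ true → x ∷ W ↭ C → IsBasis (y ∷ W) → IsBasis (x ∷ V) →
        count G (y ∷ V) ≤ count G B → count G (x ∷ V) ≤ count G B
      step {x} {y} {W} {V} Ex _ _ _ le rewrite E∩G Ex = ℕ.≤-trans (ℕ.m≤n+m (count G V) (χ (G y))) le
    ... | V , b , le = Q ++ V , (b , ℕ.≤-antisym (maximal b) (begin
        r                     ≡⟨ eC ⟨
        count E C             ≡⟨ count-↭ E C↭ ⟩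
        count E (Q ++ R)      ≡⟨ count-++ E Q R ⟩
        count E Q + count E R ≡⟨ cong (count E Q +_) (count-none E r≡) ⟩
        count E Q + 0         ≤⟨ ℕ.+-monoʳ-≤ (count E Q) z≤n ⟩
        count E Q + count E V ≡⟨ count-++ E Q V ⟨
        count E (Q ++ V)      ∎)) , le
      where open ℕ.≤-Reasoning

    -- The direct sum decomposition: transferring `Q` into `Q′ ++ R′` only ever exchanges elements
    -- of `E` for elements of `E`, by `exchange-class`, so the part outside `E` remains `R′`.
    mix : ∀ {Q R Q′ R′} → IsOptimal (Q ++ R) → IsOptimal (Q′ ++ R′) →
      All (λ x → E x ≡ true) Q → All (λ x → E x ≡ false) R →
      All (λ x → E x ≡ true) Q′ → All (λ x → E x ≡ false) R′ →
      IsOptimal (Q ++ R′)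
    mix {Q} {R} {Q′} {R′} (b , e) (b′ , e′) q r≡ q′ r′≡ = finish
      (transfer-all (λ xs → count E xs ≡ r × outside xs ↭ R′) Q R
        (λ p (eq , o) → trans (sym (count-↭ E p)) eq , ↭-trans (filter-↭ outside? (↭-sym p)) o)
        step b ↭-refl q b′ (e′ , ↭-reflexive (outside-++ q′ r′≡)))
      where
      outside? = λ x → E x Bool.≟ false
      outside : List X → List X
      outside = filter outside?
      outside-++ : ∀ {Q R} → All (λ x → E x ≡ true) Q → All (λ x → E x ≡ false) R → outside (Q ++ R) ≡ R
      outside-++ {Q} {R} q r = trans (List.filter-++ outside? Q R)
        (cong₂ _++_ (List.filter-none outside? (All.map (λ t f → contradiction (trans (sym t) f) λ ()) q))
          (List.filter-all outside? r))
      step : ∀ {x y W V} → E x ≡ true → x ∷ W ↭ Q ++ R → IsBasis (y ∷ W) → IsBasis (x ∷ V) →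
        count E (y ∷ V) ≡ r × outside (y ∷ V) ↭ R′ → count E (x ∷ V) ≡ r × outside (x ∷ V) ↭ R′
      step {x} {y} {W} {V} Ex p yW xV (eq , o) = proj₂ (exchange-optimal Ex≡Ey xV eq) ,
        subst (_↭ R′) (trans (reject (trans (sym Ex≡Ey) Ex)) (sym (reject Ex))) o
        where
        Ex≡Ey = exchange-class (trans (count-↭ E p) e) yW xV eq
        reject : ∀ {z} → E z ≡ true → outside (z ∷ V) ≡ outside V
        reject Ez = List.filter-reject outside? (λ f → contradiction (trans (sym Ez) f) λ ())
      finish : (∃ λ V → IsBasis (Q ++ V) × count E (Q ++ V) ≡ r × outside (Q ++ V) ↭ R′) → IsOptimal (Q ++ R′)
      finish (V , b″ , e″ , o) = IsOptimal-↭ (++⁺ˡ Q (subst (_↭ R′) (outside-++ q v) o)) (b″ , e″)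
        where
        open ≡-Reasoning
        -- `Q` alone already accounts for all r elements in `E`, so what remains lies outside `E`
        -- and must be `R′`.
        v : All (λ x → E x ≡ false) V
        v = count≡0⇒none E V (ℕ.+-cancelˡ-≡ (count E Q) _ _ (begin
          count E Q + count E V ≡⟨ count-++ E Q V ⟨
          count E (Q ++ V)      ≡⟨ e″ ⟩
          r                     ≡⟨ e ⟨
          count E (Q ++ R)      ≡⟨ count-++ E Q R ⟩
          count E Q + count E R ≡⟨ cong (count E Q +_) (count-none E r≡) ⟩
          count E Q + 0         ∎))

    square : ∀ {x y u v W W′} → E x ≡ true → E y ≡ true → E u ≡ false → E v ≡ false →
      IsOptimal (x ∷ W) → IsOptimal (y ∷ W) → IsOptimal (u ∷ W′) → IsOptimal (v ∷ W′) →
      ∃ λ Z → IsOptimal (x ∷ u ∷ Z) × IsOptimal (x ∷ v ∷ Z) × IsOptimal (y ∷ u ∷ Z) × IsOptimal (y ∷ v ∷ Z)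
    square {W = W} {W′} Ex Ey Eu Ev xW yW uW′ vW′ with separate E W | separate E W′
    ... | Q , R , W↭ , q , r≡ | Q′ , R′ , W′↭ , q′ , r′≡ =
      -- The common part takes its elements in `E` from `W` and those outside `E` from `W′`.
      Q ++ R′ , combine Ex Eu xW uW′ , combine Ex Ev xW vW′ , combine Ey Eu yW uW′ , combine Ey Ev yW vW′
      where
      combine : ∀ {s t} → E s ≡ true → E t ≡ false → IsOptimal (s ∷ W) → IsOptimal (t ∷ W′) →
        IsOptimal (s ∷ t ∷ Q ++ R′)
      combine {s} {t} Es Et sW tW′ = IsOptimal-↭ (prep s (shift t Q R′))
        (mix {s ∷ Q} {R} {Q′} {t ∷ R′} (IsOptimal-↭ (prep s W↭) sW)
          (IsOptimal-↭ (↭-trans (prep t W′↭) (↭-sym (shift t Q′ R′))) tW′)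
          (Es ∷ q) r≡ q′ (Et ∷ r′≡))

-- Ranks and minima as extrema over the list of bases

module _ {X : Set} where

  max-upper : ∀ (f : X → ℕ) {v xs} → v ∈ˡ xs → f v ≤ foldr (λ B r → f B ⊔ r) 0 xs
  max-upper f (here refl) = ℕ.m≤m⊔n _ _
  max-upper f (there v∈)  = ℕ.≤-trans (max-upper f v∈) (ℕ.m≤n⊔m _ _)

  max-attained : ∀ (f : X → ℕ) {v xs} → v ∈ˡ xs → ∃ λ w → w ∈ˡ xs × f w ≡ foldr (λ B r → f B ⊔ r) 0 xs
  max-attained f {xs = x ∷ []}     _  = x , here refl , sym (ℕ.⊔-identityʳ (f x))
  max-attained f {xs = x ∷ y ∷ xs} _ with max-attained f {xs = y ∷ xs} (here refl)
  ... | w , w∈ , eq with ℕ.⊔-sel (f x) (foldr (λ B r → f B ⊔ r) 0 (y ∷ xs))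
  ... | inj₁ max≡x = x , here refl , sym max≡x
  ... | inj₂ max≡r = w , there w∈ , trans eq (sym max≡r)

  min-lower : ∀ (f : X → ℕ) {m v xs} → v ∈ˡ xs → foldr (λ B r → f B ⊓ r) m xs ≤ f v
  min-lower f (here refl) = ℕ.m⊓n≤m _ _
  min-lower f (there v∈)  = ℕ.≤-trans (ℕ.m⊓n≤n _ _) (min-lower f v∈)

  -- The bound on one value keeps the default `m` from undercutting all values of `f`.
  min-attained : ∀ (f : X → ℕ) {m v xs} → f v ≤ m → v ∈ˡ xs →
    ∃ λ w → w ∈ˡ xs × f w ≤ foldr (λ B r → f B ⊓ r) m xs
  min-attained f {m} {v} {xs} v≤m v∈ = [ (λ le → v , v∈ , ℕ.≤-trans v≤m le) , (λ w → w) ]′ (attained xs)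
    where
    attained : ∀ xs → m ≤ foldr (λ B r → f B ⊓ r) m xs ⊎
      ∃ λ w → w ∈ˡ xs × f w ≤ foldr (λ B r → f B ⊓ r) m xs
    attained []       = inj₁ ℕ.≤-refl
    attained (x ∷ xs) with ℕ.⊓-sel (f x) (foldr (λ B r → f B ⊓ r) m xs) | attained xs
    ... | inj₁ min≡x | _                    = inj₂ (x , here refl , ℕ.≤-reflexive (sym min≡x))
    ... | inj₂ min≡r | inj₁ le              = inj₁ (ℕ.≤-trans le (ℕ.≤-reflexive (sym min≡r)))
    ... | inj₂ min≡r | inj₂ (w , w∈ , le)   = inj₂ (w , there w∈ , ℕ.≤-trans le (ℕ.≤-reflexive (sym min≡r)))

  count≤length : ∀ (S : X → Bool) xs → count S xs ≤ length xs
  count≤length S []       = z≤n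
  count≤length S (x ∷ xs) with S x
  ... | true  = s≤s (count≤length S xs)
  ... | false = ℕ.m≤n⇒m≤1+n (count≤length S xs)

countIn≡count : ∀ {n k} (S : Fin n → Bool) (v : Vec (Fin n) k) → countIn S v ≡ count S (Vec.toList v)
countIn≡count S []      = refl
countIn≡count S (x ∷ v) = cong (χ (S x) +_) (countIn≡count S v)

module Rank {d n : ℕ} (A : Matrix d n) (full : FullRank A) where
  open Positroid A

  some-basis : ∃ λ v → v ∈ˡ bases A
  some-basis with find full
  ... | v , v∈ , minor≢0 = v , ∈-filter⁺ (λ c → ¬? (minor A c ℚ.≟ 0ℚ)) v∈ minor≢0

  count-bases⁺ : ∀ S {c} → IsBasis c → ∃ λ v → v ∈ˡ bases A × countIn S v ≡ count S c
  count-bases⁺ S b with bases⁺ b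
  ... | v , v∈ , v↭c = v , v∈ , trans (countIn≡count S v) (count-↭ S v↭c)

  rk-upper : ∀ S {c} → IsBasis c → count S c ≤ rk A S
  rk-upper S b with count-bases⁺ S b
  ... | v , v∈ , eq = subst (_≤ rk A S) eq (max-upper (countIn S) v∈)

  rk-attained : ∀ S → ∃ λ c → IsBasis c × count S c ≡ rk A S
  rk-attained S with max-attained (countIn S) (proj₂ some-basis)
  ... | v , v∈ , eq = Vec.toList v , bases⁻ v∈ , trans (sym (countIn≡count S v)) eq

  minCount-lower : ∀ S {c} → IsBasis c → minCount A S ≤ count S c
  minCount-lower S b with count-bases⁺ S b
  ... | v , v∈ , eq = subst (minCount A S ≤_) eq (min-lower (countIn S) v∈)

  -- Keeps every count at most n, the default in `minCount`: an increasing rearrangement is a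
  -- sublist of the list of all n elements.
  IsBasis-length≤n : ∀ {c} → IsBasis c → length c ≤ n
  IsBasis-length≤n {c} b = subst₂ _≤_ (↭-length (sorted-↭ (D-unique rows b))) (List.length-tabulate (λ i → i))
    (length-mono-≤ (filter-⊆ _ (List.allFin n)))

  minCount-attained : ∀ S → ∃ λ c → IsBasis c × count S c ≤ minCount A S
  minCount-attained S with some-basis
  ... | v , v∈ with min-attained (countIn S) {n} (ℕ.≤-trans (ℕ.≤-reflexive (countIn≡count S v))
                      (ℕ.≤-trans (count≤length S (Vec.toList v)) (IsBasis-length≤n (bases⁻ v∈)))) v∈
  ... | w , w∈ , le = Vec.toList w , bases⁻ w∈ , ℕ.≤-trans (ℕ.≤-reflexive (sym (countIn≡count S w))) le

  rk-cong : ∀ {S S′} → (∀ x → S x ≡ S′ x) → rk A S ≡ rk A S′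
  rk-cong {S} {S′} S≈S′ = max-cong (bases A)
    where
    countIn-cong : ∀ {k} (v : Vec (Fin n) k) → countIn S v ≡ countIn S′ v
    countIn-cong []      = refl
    countIn-cong (x ∷ v) = cong₂ _+_ (cong χ (S≈S′ x)) (countIn-cong v)
    max-cong : ∀ xs → foldr (λ B r → countIn S B ⊔ r) 0 xs ≡ foldr (λ B r → countIn S′ B ⊔ r) 0 xs
    max-cong []       = refl
    max-cong (x ∷ xs) = cong₂ _⊔_ (countIn-cong x) (max-cong xs)

  count-all : ∀ {X : Set} (xs : List X) → count (λ _ → true) xs ≡ length xs
  count-all []       = refl
  count-all (x ∷ xs) = cong suc (count-all xs)

  rk-all : rk A (λ _ → true) ≡ d
  rk-all with rk-attained (λ _ → true)
  ... | c , b , eq = trans (sym eq) (trans (count-all c) (IsBasis-length b))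

-- Positions on the circle

-- By definition, dist a x is forward n (toℕ a) (toℕ x).
forward : ℕ → ℕ → ℕ → ℕ
forward n p q = if p ≤ᵇ q then q ∸ p else (n + q) ∸ p

≤ᵇ-true : ∀ {m n} → m ≤ n → (m ≤ᵇ n) ≡ true
≤ᵇ-true {m} {n} m≤n with m ≤ᵇ n | ℕ.≤ᵇ-reflects-≤ m n
... | true  | _      = refl
... | false | ofⁿ ¬p = contradiction m≤n ¬p

≤ᵇ-false : ∀ {m n} → n < m → (m ≤ᵇ n) ≡ false
≤ᵇ-false {m} {n} n<m with m ≤ᵇ n | ℕ.≤ᵇ-reflects-≤ m n
... | true  | ofʸ p = contradiction n<m (ℕ.≤⇒≯ p)
... | false | _     = refl

forward-≤ : ∀ {n p q} → p ≤ q → forward n p q ≡ q ∸ p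
forward-≤ {n} {p} {q} p≤q rewrite ≤ᵇ-true p≤q = refl

forward-> : ∀ {n p q} → q < p → forward n p q ≡ (n + q) ∸ p
forward-> {n} {p} {q} q<p rewrite ≤ᵇ-false q<p = refl

-- The two branches of `forward` as additive equations, free of truncated subtraction.
Steps : ℕ → ℕ → ℕ → ℕ → Set
Steps n p q r = (p ≤ q × r + p ≡ q) ⊎ (q < p × r + p ≡ n + q)

forward-steps : ∀ {n} p q → p < n → Steps n p q (forward n p q)
forward-steps {n} p q p<n with p ℕ.≤? q
... | yes p≤q rewrite forward-≤ {n} p≤q = inj₁ (p≤q , ℕ.m∸n+n≡m p≤q)
... | no  p≰q rewrite forward-> {n} (ℕ.≰⇒> p≰q) =
  inj₂ (ℕ.≰⇒> p≰q , ℕ.m∸n+n≡m (ℕ.≤-trans (ℕ.<⇒≤ p<n) (ℕ.m≤m+n n q)))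

forward-< : ∀ {n p q} → p < n → q < n → forward n p q < n
forward-< {n} {p} {q} p<n q<n with forward-steps p q p<n
... | inj₁ (_ , eq)   = ℕ.≤-<-trans (ℕ.≤-trans (ℕ.m≤m+n _ p) (ℕ.≤-reflexive eq)) q<n
... | inj₂ (q<p , eq) = ℕ.+-cancelʳ-< p _ n (subst (_< n + p) (sym eq) (ℕ.+-monoʳ-< n q<p))

forward-unique : ∀ {n p q r} → r < n → r + p ≡ q ⊎ r + p ≡ n + q → r ≡ forward n p q
forward-unique {n} {p} {q} {r} r<n (inj₁ eq) = begin
  r             ≡⟨ ℕ.m+n∸n≡m r p ⟨
  r + p ∸ p     ≡⟨ cong (_∸ p) eq ⟩
  q ∸ p         ≡⟨ forward-≤ {n} (subst (p ≤_) eq (ℕ.m≤n+m p r)) ⟨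
  forward n p q ∎
  where open ≡-Reasoning
forward-unique {n} {p} {q} {r} r<n (inj₂ eq) = begin
  r             ≡⟨ ℕ.m+n∸n≡m r p ⟨
  r + p ∸ p     ≡⟨ cong (_∸ p) eq ⟩
  n + q ∸ p     ≡⟨ forward-> {n} (ℕ.+-cancelˡ-< n q p (subst (_< n + p) eq (ℕ.+-monoˡ-< p r<n))) ⟨
  forward n p q ∎
  where open ≡-Reasoning

-- Distances are invariant under rotation, so all intervals may be described by positions counted
-- from one origin. Two of the eight patterns of wrapping around are contradictory.
forward-rebase : ∀ {n o p q} → o < n → p < n → q < n → forward n (forward n o p) (forward n o q) ≡ forward n p q
forward-rebase {n} {o} {p} {q} o<n p<n q<n = sym (forward-unique (forward-< p<n q<n) steps)
  where
  open ≡-Reasoning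
  F = forward n p q
  P = forward n o p
  Q = forward n o q
  cancel-o : ∀ {t} → F + P + o ≡ t + o → F + P ≡ t
  cancel-o = ℕ.+-cancelʳ-≡ o (F + P) _
  to-p : ∀ {p′ t} → P + o ≡ p′ → F + p′ ≡ t → F + P + o ≡ t
  to-p eP eF = trans (ℕ.+-assoc F P o) (trans (cong (F +_) eP) eF)
  wrap : ∀ {t} → F + p ≡ t → F + (n + p) ≡ n + t
  wrap eF = trans (swap-front F n p) (cong (n +_) eF)
    where
    swap-front : ∀ a b c → a + (b + c) ≡ b + (a + c)
    swap-front = solve-∀
  shift-o : ∀ {t} → Q + o ≡ t → n + t ≡ n + Q + o
  shift-o eQ = trans (cong (n +_) (sym eQ)) (sym (ℕ.+-assoc n Q o))
  steps : F + P ≡ Q ⊎ F + P ≡ n + Q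
  steps with forward-steps {n} o p o<n | forward-steps {n} o q o<n | forward-steps {n} p q p<n
  ... | inj₁ (_ , eP)   | inj₁ (_ , eQ)   | inj₁ (_ , eF)   = inj₁ (cancel-o (trans (to-p eP eF) (sym eQ)))
  ... | inj₁ (_ , eP)   | inj₁ (_ , eQ)   | inj₂ (_ , eF)   = inj₂ (cancel-o (trans (to-p eP eF) (shift-o eQ)))
  ... | inj₁ (o≤p , _)  | inj₂ (q<o , _)  | inj₁ (p≤q , _)  = contradiction (ℕ.≤-trans o≤p p≤q) (ℕ.<⇒≱ q<o)
  ... | inj₁ (_ , eP)   | inj₂ (_ , eQ)   | inj₂ (_ , eF)   = inj₁ (cancel-o (trans (to-p eP eF) (sym eQ)))
  ... | inj₂ (_ , eP)   | inj₁ (_ , eQ)   | inj₁ (_ , eF)   = inj₂ (cancel-o (trans (to-p eP (wrap eF)) (shift-o eQ)))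
  ... | inj₂ (p<o , _)  | inj₁ (o≤q , _)  | inj₂ (q<p , _)  = contradiction (ℕ.<-trans q<p p<o) (ℕ.≤⇒≯ o≤q)
  ... | inj₂ (_ , eP)   | inj₂ (_ , eQ)   | inj₁ (_ , eF)   = inj₁ (cancel-o (trans (to-p eP (wrap eF)) (sym eQ)))
  ... | inj₂ (_ , eP)   | inj₂ (_ , eQ)   | inj₂ (_ , eF)   = inj₂ (cancel-o (trans (to-p eP (wrap eF)) (shift-o eQ)))

forward-<-cases : ∀ {n o p q} → o < n → p < n → q < n → forward n o p < forward n o q →
  (o ≤ p × o ≤ q × p < q) ⊎ (o ≤ p × q < o) ⊎ (p < o × q < o × p < q)
forward-<-cases {n} {o} {p} {q} o<n p<n q<n lt with forward-steps {n} o p o<n | forward-steps {n} o q o<n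
... | inj₁ (o≤p , eP) | inj₁ (o≤q , eQ) = inj₁ (o≤p , o≤q , subst₂ _<_ eP eQ (ℕ.+-monoˡ-< o lt))
... | inj₁ (o≤p , eP) | inj₂ (q<o , eQ) = inj₂ (inj₁ (o≤p , q<o))
... | inj₂ (p<o , eP) | inj₁ (o≤q , eQ) = contradiction
  (ℕ.<-trans (ℕ.≤-<-trans (ℕ.m≤m+n n p) (subst₂ _<_ eP eQ (ℕ.+-monoˡ-< o lt))) q<n) (ℕ.<-irrefl refl)
... | inj₂ (p<o , eP) | inj₂ (q<o , eQ) =
  inj₂ (inj₂ (p<o , q<o , ℕ.+-cancelˡ-< n p q (subst₂ _<_ eP eQ (ℕ.+-monoˡ-< o lt))))

module _ {n : ℕ} (o : Fin n) where

  private
    pos = dist o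

  dist-rebase : ∀ a x → forward n (pos a) (pos x) ≡ dist a x
  dist-rebase a x = forward-rebase (Fin.toℕ<n o) (Fin.toℕ<n a) (Fin.toℕ<n x)

  dist<n : ∀ x → pos x < n
  dist<n x = forward-< (Fin.toℕ<n o) (Fin.toℕ<n x)

  inCI-pos : ∀ a b x → inCI a b x ≡ (forward n (pos a) (pos x) ≤ᵇ forward n (pos a) (pos b))
  inCI-pos a b x = sym (cong₂ _≤ᵇ_ (dist-rebase a x) (dist-rebase a b))

  module _ {a b : Fin n} (a≤b : pos a ≤ pos b) {x : Fin n} where

    inCI-direct : pos a ≤ pos x → pos x ≤ pos b → inCI a b x ≡ true
    inCI-direct a≤x x≤b = trans (inCI-pos a b x)
      (≤ᵇ-true (subst₂ _≤_ (sym (forward-≤ {n} a≤x)) (sym (forward-≤ {n} a≤b)) (ℕ.∸-monoˡ-≤ (pos a) x≤b)))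

    inCI-direct-before : pos x < pos a → inCI a b x ≡ false
    inCI-direct-before x<a = trans (inCI-pos a b x)
      (≤ᵇ-false (subst₂ _<_ (sym (forward-≤ {n} a≤b)) (sym (forward-> {n} x<a))
        (ℕ.∸-monoˡ-< (ℕ.<-≤-trans (dist<n b) (ℕ.m≤m+n n (pos x))) a≤b)))

    inCI-direct-after : pos b < pos x → inCI a b x ≡ false
    inCI-direct-after b<x = trans (inCI-pos a b x)
      (≤ᵇ-false (subst₂ _<_ (sym (forward-≤ {n} a≤b)) (sym (forward-≤ {n} (ℕ.≤-trans a≤b (ℕ.<⇒≤ b<x))))
        (ℕ.∸-monoˡ-< b<x a≤b)))

  module _ {a b : Fin n} (b<a : pos b < pos a) {x : Fin n} where

    private
      a≤n+ : ∀ y → pos a ≤ n + y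
      a≤n+ y = ℕ.≤-trans (ℕ.<⇒≤ (dist<n a)) (ℕ.m≤m+n n y)

    inCI-wrap-left : pos a ≤ pos x → inCI a b x ≡ true
    inCI-wrap-left a≤x = trans (inCI-pos a b x)
      (≤ᵇ-true (subst₂ _≤_ (sym (forward-≤ {n} a≤x)) (sym (forward-> {n} b<a))
        (ℕ.∸-monoˡ-≤ (pos a) (ℕ.≤-trans (ℕ.<⇒≤ (dist<n x)) (ℕ.m≤m+n n (pos b))))))

    inCI-wrap-right : pos x ≤ pos b → inCI a b x ≡ true
    inCI-wrap-right x≤b = trans (inCI-pos a b x)
      (≤ᵇ-true (subst₂ _≤_ (sym (forward-> {n} (ℕ.≤-<-trans x≤b b<a))) (sym (forward-> {n} b<a))
        (ℕ.∸-monoˡ-≤ (pos a) (ℕ.+-monoʳ-≤ n x≤b))))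

    inCI-wrap-out : pos b < pos x → pos x < pos a → inCI a b x ≡ false
    inCI-wrap-out b<x x<a = trans (inCI-pos a b x)
      (≤ᵇ-false (subst₂ _<_ (sym (forward-> {n} b<a)) (sym (forward-> {n} x<a))
        (ℕ.∸-monoˡ-< (ℕ.+-monoʳ-< n b<x) (a≤n+ (pos b)))))

-- Total nonnegativity enters only through diagonal.
record PositroidAxioms (n d : ℕ) : Set₁ where
  field
    IsBasis        : List (Fin n) → Set
    IsBasis-↭      : ∀ {xs ys} → xs ↭ ys → IsBasis xs → IsBasis ys
    IsBasis-∉      : ∀ {x xs} → IsBasis (x ∷ xs) → x ∉ˡ xs
    IsBasis-length : ∀ {B} → IsBasis B → length B ≡ d
    exchange       : ∀ {x W B} → IsBasis (x ∷ W) → IsBasis B →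
      ∃ λ y → ∃ λ V → B ↭ y ∷ V × IsBasis (y ∷ W) × IsBasis (x ∷ V)
    diagonal       : ∀ {e₁ e₂ e₃ e₄ W} → e₁ Fin.< e₂ → e₂ Fin.< e₃ → e₃ Fin.< e₄ →
      IsBasis (e₁ ∷ e₂ ∷ W) → IsBasis (e₂ ∷ e₃ ∷ W) → IsBasis (e₃ ∷ e₄ ∷ W) → IsBasis (e₁ ∷ e₄ ∷ W) →
      IsBasis (e₁ ∷ e₃ ∷ W) × IsBasis (e₂ ∷ e₄ ∷ W)
    maxOn          : (Fin n → Bool) → ℕ
    maxOn-upper    : ∀ S {B} → IsBasis B → count S B ≤ maxOn S
    maxOn-attained : ∀ S → ∃ λ B → IsBasis B × count S B ≡ maxOn S
    minOn          : (Fin n → Bool) → ℕ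
    minOn-lower    : ∀ S {B} → IsBasis B → minOn S ≤ count S B
    minOn-attained : ∀ S → ∃ λ B → IsBasis B × count S B ≤ minOn S

-- The diagonal relation in an arbitrary cyclic order

module Cyclic {d n : ℕ} (M : PositroidAxioms n d) (o : Fin n) where
  open PositroidAxioms M
  private
    pos = dist o

  IsBasis-swap : ∀ {x y W} → IsBasis (x ∷ y ∷ W) → IsBasis (y ∷ x ∷ W)
  IsBasis-swap = IsBasis-↭ (swap _ _ ↭-refl)

  data Advance (x y : Fin n) : Set where
    low   : toℕ o ≤ toℕ x → toℕ o ≤ toℕ y → x Fin.< y → Advance x y
    cross : toℕ o ≤ toℕ x → y Fin.< o → Advance x y
    high  : x Fin.< o → y Fin.< o → x Fin.< y → Advance x y

  advance : ∀ {x y} → pos x < pos y → Advance x y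
  advance {x} {y} x<y with forward-<-cases (Fin.toℕ<n o) (Fin.toℕ<n x) (Fin.toℕ<n y) x<y
  ... | inj₁ (o≤x , o≤y , l)        = low o≤x o≤y l
  ... | inj₂ (inj₁ (o≤x , y<o))     = cross o≤x y<o
  ... | inj₂ (inj₂ (x<o , y<o , l)) = high x<o y<o l

  -- Points in order from `o` are increasing as numbers after a rotation of the four. The rotation
  -- permutes the four sides of the quadrilateral and its two diagonals, so `diagonal` applies; the
  -- case is fixed by where the numbering wraps.
  cyclic-diagonal : ∀ {e₁ e₂ e₃ e₄ W} → pos e₁ < pos e₂ → pos e₂ < pos e₃ → pos e₃ < pos e₄ →
    IsBasis (e₁ ∷ e₂ ∷ W) → IsBasis (e₂ ∷ e₃ ∷ W) → IsBasis (e₃ ∷ e₄ ∷ W) → IsBasis (e₁ ∷ e₄ ∷ W) →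
    IsBasis (e₁ ∷ e₃ ∷ W) × IsBasis (e₂ ∷ e₄ ∷ W)
  cyclic-diagonal {e₁} {e₂} {e₃} {e₄} {W} l₁₂ l₂₃ l₃₄ b₁₂ b₂₃ b₃₄ b₁₄ =
    rotated (advance l₁₂) (advance l₂₃) (advance l₃₄)
    where
    rotated : Advance e₁ e₂ → Advance e₂ e₃ → Advance e₃ e₄ → IsBasis (e₁ ∷ e₃ ∷ W) × IsBasis (e₂ ∷ e₄ ∷ W)
    rotated (low _ _ l) (low _ _ m) (low _ _ k) = diagonal l m k b₁₂ b₂₃ b₃₄ b₁₄
    rotated (low o≤1 _ l) (low _ _ m) (cross _ 4<o) =
      let b₄₂ , b₁₃ = diagonal (ℕ.<-≤-trans 4<o o≤1) l m (IsBasis-swap b₁₄) b₁₂ b₂₃ (IsBasis-swap b₃₄)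
      in b₁₃ , IsBasis-swap b₄₂
    rotated (low o≤1 _ l) (cross _ 3<o) (high _ 4<o k) =
      let b₃₁ , b₄₂ = diagonal k (ℕ.<-≤-trans 4<o o≤1) l b₃₄ (IsBasis-swap b₁₄) b₁₂ (IsBasis-swap b₂₃)
      in IsBasis-swap b₃₁ , IsBasis-swap b₄₂
    rotated (cross o≤1 _) (high _ _ m) (high _ 4<o k) =
      let b₂₄ , b₃₁ = diagonal m k (ℕ.<-≤-trans 4<o o≤1) b₂₃ b₃₄ (IsBasis-swap b₁₄) (IsBasis-swap b₁₂)
      in IsBasis-swap b₃₁ , b₂₄
    rotated (high _ _ l) (high _ _ m) (high _ _ k) = diagonal l m k b₁₂ b₂₃ b₃₄ b₁₄
    rotated (low _ o≤2 _) (high 2<o _ _) _ = contradiction 2<o (ℕ.≤⇒≯ o≤2)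
    rotated (low _ o≤2 _) (low _ o≤3 _) (high 3<o _ _) = contradiction 3<o (ℕ.≤⇒≯ o≤3)
    rotated _ (cross _ 3<o) (low o≤3 _ _) = contradiction 3<o (ℕ.≤⇒≯ o≤3)
    rotated _ (cross _ 3<o) (cross o≤3 _) = contradiction 3<o (ℕ.≤⇒≯ o≤3)
    rotated (cross _ 2<o) (low o≤2 _ _) _ = contradiction 2<o (ℕ.≤⇒≯ o≤2)
    rotated (cross _ 2<o) (cross o≤2 _) _ = contradiction 2<o (ℕ.≤⇒≯ o≤2)
    rotated (high _ 2<o _) (low o≤2 _ _) _ = contradiction 2<o (ℕ.≤⇒≯ o≤2)
    rotated (high _ 2<o _) (cross o≤2 _) _ = contradiction 2<o (ℕ.≤⇒≯ o≤2)
    rotated _ (high _ 3<o _) (low o≤3 _ _) = contradiction 3<o (ℕ.≤⇒≯ o≤3)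
    rotated _ (high _ 3<o _) (cross o≤3 _) = contradiction 3<o (ℕ.≤⇒≯ o≤3)

-- Cyclically consecutive pairs

links : ∀ {X : Set} → X → List X → List (X × X)
links x []           = []
links x (y ∷ [])     = (y , x) ∷ []
links x (y ∷ z ∷ zs) = (y , z) ∷ links x (z ∷ zs)

mutual
  cyclicPairs≡links : ∀ {X : Set} (x : X) xs → cyclicPairs (x ∷ xs) ≡ links x (x ∷ xs)
  -- Generalises the traversed list while the closing point `x` stays fixed, as the induction
  -- requires.
  cyclicPairs≡links x xs with x ∷ xs
  ... | l = go≡links x xs l

  -- The left-hand side is the local function of cyclicPairs, which has no name here.
  go≡links : ∀ {X : Set} (x : X) (xs l : List X) → _ ≡ links x l
  go≡links x xs []           = refl
  go≡links x xs (y ∷ [])     = refl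
  go≡links x xs (y ∷ z ∷ zs) = cong ((y , z) ∷_) (go≡links x xs (z ∷ zs))

links-∈ : ∀ {X : Set} {x : X} {l p} → x ∈ˡ l → p ∈ˡ links x l → proj₁ p ∈ˡ l × proj₂ p ∈ˡ l
links-∈ {l = l} x∈l = within l (λ z → z)
  where
  within : ∀ l′ {p} → (∀ {y} → y ∈ˡ l′ → y ∈ˡ l) → p ∈ˡ links _ l′ → proj₁ p ∈ˡ l × proj₂ p ∈ˡ l
  within (y ∷ [])     sub (here refl) = sub (here refl) , x∈l
  within (y ∷ z ∷ zs) sub (here refl) = sub (here refl) , sub (there (here refl))
  within (y ∷ z ∷ zs) sub (there p∈)  = within (z ∷ zs) (sub ∘ there) p∈

cyclicPairs-∈ : ∀ {X : Set} {T : List X} {p} → p ∈ˡ cyclicPairs T → proj₁ p ∈ˡ T × proj₂ p ∈ˡ T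
cyclicPairs-∈ {T = x ∷ xs} {p} p∈ = links-∈ (here refl) (subst (p ∈ˡ_) (cyclicPairs≡links x xs) p∈)

interchange : ∀ a b c d → (a + b) + (c + d) ≡ (a + c) + (b + d)
interchange = solve-∀

module _ {X : Set} where

  total : (X → ℕ) → List X → ℕ
  total f []       = 0
  total f (x ∷ xs) = f x + total f xs

  total-+ : ∀ f g xs → total (λ x → f x + g x) xs ≡ total f xs + total g xs
  total-+ f g []       = refl
  total-+ f g (x ∷ xs) = trans (cong ((f x + g x) +_) (total-+ f g xs)) (interchange (f x) (g x) (total f xs) (total g xs))

  total-zero : ∀ xs → total (λ _ → 0) xs ≡ 0
  total-zero []       = refl
  total-zero (x ∷ xs) = total-zero xs

  ≤-total : ∀ f {x xs} → x ∈ˡ xs → f x ≤ total f xs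
  ≤-total f (here refl) = ℕ.m≤m+n _ _
  ≤-total f (there x∈)  = ℕ.≤-trans (≤-total f x∈) (ℕ.m≤n+m _ _)

  total-cong : ∀ {f g} xs → (∀ {x} → x ∈ˡ xs → f x ≡ g x) → total f xs ≡ total g xs
  total-cong []       eq = refl
  total-cong (x ∷ xs) eq = cong₂ _+_ (eq (here refl)) (total-cong xs (eq ∘ there))

  total-filter : ∀ {P : X → Set} (P? : Unary.Decidable P) f xs →
    total f xs ≡ total f (filter P? xs) + total f (filter (¬? ∘ P?) xs)
  total-filter P? f []       = refl
  total-filter P? f (x ∷ xs) with P? x
  ... | yes _ = trans (cong (f x +_) (total-filter P? f xs)) (sym (ℕ.+-assoc (f x) _ _))
  ... | no  _ = trans (cong (f x +_) (total-filter P? f xs))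
    (left-comm (f x) (total f (filter P? xs)) (total f (filter (¬? ∘ P?) xs)))
    where
    left-comm : ∀ a b c → a + (b + c) ≡ b + (a + c)
    left-comm = solve-∀

-- Intervals and gaps as ranges of positions

module Arcs {n s : ℕ} (o : Fin n) (a b : Fin s → Fin n)
  (a≤b : ∀ i → dist o (a i) ≤ dist o (b i))
  (b<a : ∀ i j → i Fin.< j → dist o (b i) < dist o (a j))
  (disjoint : Disjoint a b) where

  pos : Fin n → ℕ
  pos = dist o

  α β : Fin s → ℕ
  α i = pos (a i)
  β i = pos (b i)

  arc : Fin s → Fin n → Bool
  arc i = inCI (a i) (b i)

  gap : Fin s × Fin s → Fin n → Bool
  gap (i , j) = inOI (b i) (a j)

  union : List (Fin s) → Fin n → Bool
  union []      x = false
  union (i ∷ T) x = arc i x ∨ union T x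

  α-mono : ∀ {i j} → i Fin.< j → α i < α j
  α-mono {i} {j} i<j = ℕ.≤-<-trans (a≤b i) (b<a i j i<j)

  data Location (i : Fin s) (x : Fin n) : Set where
    before : pos x < α i → arc i x ≡ false → Location i x
    inside : α i ≤ pos x → pos x ≤ β i → arc i x ≡ true → Location i x
    after  : β i < pos x → arc i x ≡ false → Location i x

  locate : ∀ i x → Location i x
  locate i x with ℕ.≤-<-connex (α i) (pos x) | ℕ.≤-<-connex (pos x) (β i)
  ... | inj₂ x<α | _        = before x<α (inCI-direct-before o (a≤b i) x<α)
  ... | inj₁ α≤x | inj₁ x≤β = inside α≤x x≤β (inCI-direct o (a≤b i) α≤x x≤β)
  ... | inj₁ α≤x | inj₂ β<x = after β<x (inCI-direct-after o (a≤b i) β<x)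

  -- For `i < j` the gap is a single range of positions. For `j ≤ i` it wraps past the origin and
  -- consists of an initial and a final range.
  data GapLocation (i j : Fin s) (x : Fin n) : Set where
    between : i Fin.< j → β i < pos x → pos x < α j → gap (i , j) x ≡ true → GapLocation i j x
    left    : i Fin.< j → pos x ≤ β i → gap (i , j) x ≡ false → GapLocation i j x
    right   : i Fin.< j → α j ≤ pos x → gap (i , j) x ≡ false → GapLocation i j x
    middle  : j Fin.≤ i → α j ≤ pos x → pos x ≤ β i → gap (i , j) x ≡ false → GapLocation i j x
    start   : j Fin.≤ i → pos x < α j → gap (i , j) x ≡ true → GapLocation i j x
    end     : j Fin.≤ i → β i < pos x → gap (i , j) x ≡ true → GapLocation i j x

  α≤β : ∀ {i j} → j Fin.≤ i → α j ≤ β i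
  α≤β {i} {j} j≤i with ℕ.m≤n⇒m<n∨m≡n j≤i
  ... | inj₁ j<i = ℕ.≤-trans (ℕ.<⇒≤ (α-mono j<i)) (a≤b i)
  ... | inj₂ j≡i rewrite Fin.toℕ-injective j≡i = a≤b i

  locate-gap : ∀ i j x → GapLocation i j x
  locate-gap i j x with ℕ.≤-<-connex (toℕ j) (toℕ i) | ℕ.≤-<-connex (pos x) (β i) | ℕ.≤-<-connex (α j) (pos x)
  ... | inj₁ j≤i | inj₁ x≤β | inj₁ α≤x = middle j≤i α≤x x≤β (cong not (inCI-direct o (α≤β j≤i) α≤x x≤β))
  ... | inj₁ j≤i | inj₂ β<x | _        = end j≤i β<x (cong not (inCI-direct-after o (α≤β j≤i) β<x))
  ... | inj₁ j≤i | inj₁ _   | inj₂ x<α = start j≤i x<α (cong not (inCI-direct-before o (α≤β j≤i) x<α))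
  ... | inj₂ i<j | inj₁ x≤β | _        = left i<j x≤β (cong not (inCI-wrap-right o (b<a i j i<j) x≤β))
  ... | inj₂ i<j | inj₂ β<x | inj₁ α≤x = right i<j α≤x (cong not (inCI-wrap-left o (b<a i j i<j) α≤x))
  ... | inj₂ i<j | inj₂ β<x | inj₂ x<α = between i<j β<x x<α (cong not (inCI-wrap-out o (b<a i j i<j) β<x x<α))

  -- The positions from `α i` onward are interval `i`, the gap after it and the positions from `α j`
  -- onward. Along consecutive indices this telescopes.
  gap-step : ∀ {i j} x → i Fin.< j → χ (gap (i , j) x) + χ (arc i x) + χ (α j ≤ᵇ pos x) ≡ χ (α i ≤ᵇ pos x)
  gap-step {i} {j} x i<j with locate i x | locate-gap i j x
  ... | _ | middle j≤i _ _ _ = contradiction i<j (ℕ.≤⇒≯ j≤i)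
  ... | _ | start j≤i _ _    = contradiction i<j (ℕ.≤⇒≯ j≤i)
  ... | _ | end j≤i _ _      = contradiction i<j (ℕ.≤⇒≯ j≤i)
  ... | before x<α e | left _ _ g
    rewrite e | g | ≤ᵇ-false x<α | ≤ᵇ-false (ℕ.<-trans x<α (α-mono i<j)) = refl
  ... | before x<α e | right _ α≤x _ = contradiction (ℕ.<-trans x<α (α-mono i<j)) (ℕ.≤⇒≯ α≤x)
  ... | before x<α e | between _ β<x _ _ = contradiction (ℕ.<-≤-trans x<α (a≤b i)) (ℕ.<⇒≯ β<x)
  ... | inside α≤x x≤β e | left _ _ g
    rewrite e | g | ≤ᵇ-true α≤x | ≤ᵇ-false (ℕ.≤-<-trans x≤β (b<a i j i<j)) = refl
  ... | inside α≤x x≤β e | right _ α≤x′ _ = contradiction (ℕ.≤-<-trans x≤β (b<a i j i<j)) (ℕ.≤⇒≯ α≤x′)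
  ... | inside α≤x x≤β e | between _ β<x _ _ = contradiction β<x (ℕ.≤⇒≯ x≤β)
  ... | after β<x e | left _ x≤β _ = contradiction β<x (ℕ.≤⇒≯ x≤β)
  ... | after β<x e | right _ α≤x g
    rewrite e | g | ≤ᵇ-true α≤x | ≤ᵇ-true (ℕ.≤-trans (a≤b i) (ℕ.<⇒≤ β<x)) = refl
  ... | after β<x e | between _ _ x<α g
    rewrite e | g | ≤ᵇ-false x<α | ≤ᵇ-true (ℕ.≤-trans (a≤b i) (ℕ.<⇒≤ β<x)) = refl

  -- Ends the telescoping sum: the wrapping gap also supplies the positions before `α j`.
  gap-wrap : ∀ {i j} x → j Fin.≤ i →
    χ (gap (i , j) x) + χ (arc i x) ≡ χ (not (α j ≤ᵇ pos x)) + χ (α i ≤ᵇ pos x)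
  gap-wrap {i} {j} x j≤i with locate i x | locate-gap i j x
  ... | _ | between i<j _ _ _ = contradiction i<j (ℕ.≤⇒≯ j≤i)
  ... | _ | left i<j _ _      = contradiction i<j (ℕ.≤⇒≯ j≤i)
  ... | _ | right i<j _ _     = contradiction i<j (ℕ.≤⇒≯ j≤i)
  ... | before x<α e | middle _ α≤x _ g rewrite e | g | ≤ᵇ-true α≤x | ≤ᵇ-false x<α = refl
  ... | before x<α e | start _ x<α′ g rewrite e | g | ≤ᵇ-false x<α′ | ≤ᵇ-false x<α = refl
  ... | before x<α e | end _ β<x _ = contradiction (ℕ.<-≤-trans x<α (a≤b i)) (ℕ.<⇒≯ β<x)
  ... | inside α≤x x≤β e | middle _ α≤x′ _ g rewrite e | g | ≤ᵇ-true α≤x | ≤ᵇ-true α≤x′ = refl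
  ... | inside α≤x x≤β e | start _ x<α g = contradiction x<α (ℕ.≤⇒≯ (ℕ.≤-trans (α-mono-≤ j≤i) α≤x))
    where
    α-mono-≤ : ∀ {i j} → j Fin.≤ i → α j ≤ α i
    α-mono-≤ j≤i with ℕ.m≤n⇒m<n∨m≡n j≤i
    ... | inj₁ j<i = ℕ.<⇒≤ (α-mono j<i)
    ... | inj₂ j≡i rewrite Fin.toℕ-injective j≡i = ℕ.≤-refl
  ... | inside α≤x x≤β e | end _ β<x g = contradiction β<x (ℕ.≤⇒≯ x≤β)
  ... | after β<x e | middle _ _ x≤β _ = contradiction β<x (ℕ.≤⇒≯ x≤β)
  ... | after β<x e | start _ x<α g = contradiction x<α (ℕ.≤⇒≯ (ℕ.≤-trans (α≤β j≤i) (ℕ.<⇒≤ β<x)))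
  ... | after β<x e | end _ _ g
    rewrite e | g | ≤ᵇ-true (ℕ.≤-trans (α≤β j≤i) (ℕ.<⇒≤ β<x)) | ≤ᵇ-true (ℕ.≤-trans (a≤b i) (ℕ.<⇒≤ β<x)) = refl

  links-total : ∀ x i j T → i Fin.≤ j → AllPairs Fin._<_ (j ∷ T) →
    total (λ p → χ (gap p x)) (links i (j ∷ T)) + total (λ k → χ (arc k x)) (j ∷ T) ≡
    χ (not (α i ≤ᵇ pos x)) + χ (α j ≤ᵇ pos x)
  links-total x i j [] i≤j _ = trans
    (cong₂ _+_ (ℕ.+-identityʳ (χ (gap (j , i) x))) (ℕ.+-identityʳ (χ (arc j x)))) (gap-wrap x i≤j)
  links-total x i j (k ∷ T) i≤j ((j<k ∷ _) ∷ T!) = begin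
    (g + G) + (c + C)  ≡⟨ interchange g G c C ⟩
    (g + c) + (G + C)  ≡⟨ cong (g + c +_) (links-total x i k T (ℕ.≤-trans i≤j (ℕ.<⇒≤ j<k)) T!) ⟩
    (g + c) + (N + K)  ≡⟨ regroup g c N K ⟩
    N + (g + c + K)    ≡⟨ cong (N +_) (gap-step x j<k) ⟩
    N + χ (α j ≤ᵇ pos x) ∎
    where
    open ≡-Reasoning
    g = χ (gap (j , k) x)
    G = total (λ p → χ (gap p x)) (links i (k ∷ T))
    c = χ (arc j x)
    C = total (λ k → χ (arc k x)) (k ∷ T)
    N = χ (not (α i ≤ᵇ pos x))
    K = χ (α k ≤ᵇ pos x)
    regroup : ∀ a b c d → (a + b) + (c + d) ≡ c + (a + b + d)
    regroup = solve-∀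

  arcs-total : ∀ T x → AllPairs Fin._<_ T → total (λ k → χ (arc k x)) T ≡ χ (union T x)
  arcs-total []      x _         = refl
  arcs-total (i ∷ T) x (i<T ∷ T!) with arc i x in eq
  ... | false = arcs-total T x T!
  ... | true  = cong suc (others T i<T)
    where
    others : ∀ T → All (i Fin.<_) T → total (λ k → χ (arc k x)) T ≡ 0
    others []      []        = refl
    others (j ∷ T) (i<j ∷ i<T)
      rewrite disjoint i j (λ i≡j → ℕ.<-irrefl (cong toℕ i≡j) i<j) x eq = others T i<T

  union+gaps : ∀ i T x → AllPairs Fin._<_ (i ∷ T) →
    χ (union (i ∷ T) x) + total (λ p → χ (gap p x)) (cyclicPairs (i ∷ T)) ≡ 1
  union+gaps i T x T! = begin
    χ (union (i ∷ T) x) + total g (cyclicPairs (i ∷ T))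
      ≡⟨ cong₂ _+_ (sym (arcs-total (i ∷ T) x T!)) (cong (total g) (cyclicPairs≡links i T)) ⟩
    total (λ k → χ (arc k x)) (i ∷ T) + total g (links i (i ∷ T))
      ≡⟨ ℕ.+-comm (total (λ k → χ (arc k x)) (i ∷ T)) _ ⟩
    total g (links i (i ∷ T)) + total (λ k → χ (arc k x)) (i ∷ T)
      -- The sum starts and closes at the same `i`, leaving the two complementary sides of `α i`.
      ≡⟨ links-total x i i T ℕ.≤-refl T! ⟩
    χ (not (α i ≤ᵇ pos x)) + χ (α i ≤ᵇ pos x)
      ≡⟨ χ-not (α i ≤ᵇ pos x) ⟩
    1 ∎
    where
    open ≡-Reasoning
    g = λ p → χ (gap p x)
    χ-not : ∀ t → χ (not t) + χ t ≡ 1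
    χ-not true  = refl
    χ-not false = refl

-- Decomposition into noncrossing blocks

open import Data.Integer as ℤ using (ℤ; +_)
import Data.Integer.Properties as ℤ

module _ {X : Set} where

  count-split : ∀ {S S₁ S₂ : X → Bool} → (∀ x → χ (S x) ≡ χ (S₁ x) + χ (S₂ x)) →
    ∀ c → count S c ≡ count S₁ c + count S₂ c
  count-split eq []      = refl
  count-split {S} {S₁} {S₂} eq (x ∷ c) =
    trans (cong₂ _+_ (eq x) (count-split {S} {S₁} {S₂} eq c)) (interchange (χ (S₁ x)) (χ (S₂ x)) (count S₁ c) (count S₂ c))

  filter-refine : ∀ {P Q R : X → Set} (P? : Unary.Decidable P) (Q? : Unary.Decidable Q) (R? : Unary.Decidable R) →
    (∀ {x} → Q x → P x × R x) → (∀ {x} → P x → R x → Q x) →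
    ∀ xs → filter Q? xs ≡ filter R? (filter P? xs)
  filter-refine P? Q? R? to from []       = refl
  filter-refine P? Q? R? to from (x ∷ xs) with P? x
  filter-refine P? Q? R? to from (x ∷ xs) | no ¬p with Q? x
  ... | yes q = contradiction (proj₁ (to q)) ¬p
  ... | no _  = filter-refine P? Q? R? to from xs
  filter-refine P? Q? R? to from (x ∷ xs) | yes p with Q? x | R? x
  ... | yes q | yes r = cong (x ∷_) (filter-refine P? Q? R? to from xs)
  ... | yes q | no ¬r = contradiction (proj₂ (to q)) ¬r
  ... | no ¬q | yes r = contradiction (from p r) ¬q
  ... | no ¬q | no ¬r = filter-refine P? Q? R? to from xs

χ-summand : ∀ {t p q} → χ t ≡ χ p + χ q → p ≡ true ⊎ q ≡ true → t ≡ true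
χ-summand {true}                      _  _           = refl
χ-summand {false} {true}              () (inj₁ refl)
χ-summand {false} {true}  {true}      () (inj₂ refl)
χ-summand {false} {false} {true}      () (inj₂ refl)

χ-remainder : ∀ {t p q} → χ t ≡ χ p + χ q → t ≡ true → p ≡ false → q ≡ true
χ-remainder {q = true}  _  _    _    = refl
χ-remainder {q = false} () refl refl

sumZ-cong : ∀ {p} {f g : Fin p → ℤ} → (∀ i → f i ≡ g i) → sumZ f ≡ sumZ g
sumZ-cong {zero}  eq = refl
sumZ-cong {suc p} eq = cong₂ ℤ._+_ (eq zero) (sumZ-cong (eq ∘ suc))

sumZ-+ : ∀ p {q} (f : Fin (p + q) → ℤ) → sumZ f ≡ sumZ (λ i → f (i ↑ˡ q)) ℤ.+ sumZ (λ j → f (p ↑ʳ j))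
sumZ-+ zero    f = sym (ℤ.+-identityˡ (sumZ f))
sumZ-+ (suc p) f = trans (cong (λ t → f zero ℤ.+ t) (sumZ-+ p (f ∘ suc))) (sym (ℤ.+-assoc (f zero) _ _))

module Decomposition {d n s : ℕ} (M : PositroidAxioms n d)
  (o : Fin n) (a b : Fin s → Fin n)
  (a≤b : ∀ i → dist o (a i) ≤ dist o (b i))
  (b<a : ∀ i j → i Fin.< j → dist o (b i) < dist o (a j))
  (disjoint : Disjoint a b) where

  open PositroidAxioms M
  open Cyclic M o
  open Arcs o a b a≤b b<a disjoint
  open BasisExchange IsBasis IsBasis-↭ IsBasis-∉ exchange

  rank : List (Fin s) → ℕ
  rank T = maxOn (union T)

  -- Testing the starting point suffices: an interval containing neither `u` nor `v` lies on one
  -- side of the chord, by `between-arc` and `outside-arc`.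
  Between : Fin n → Fin n → Fin s → Set
  Between u v i = pos u < α i × α i < pos v

  between? : ∀ u v → Unary.Decidable (Between u v)
  between? u v i = (pos u ℕ.<? α i) ×-dec (α i ℕ.<? pos v)

  union-true : ∀ T {x} → union T x ≡ true → ∃ λ i → i ∈ˡ T × arc i x ≡ true
  union-true (i ∷ T) {x} eq with arc i x in e
  ... | true  = i , here refl , e
  ... | false with union-true T eq
  ... | j , j∈ , e′ = j , there j∈ , e′

  union-false : ∀ {T x i} → union T x ≡ false → i ∈ˡ T → arc i x ≡ false
  union-false {j ∷ T} {x} eq i∈ with arc j x in e
  union-false {j ∷ T} {x} eq (here refl) | false = e
  union-false {j ∷ T} {x} eq (there i∈)  | false = union-false eq i∈

  before-arc : ∀ {i x} → arc i x ≡ false → pos x ≤ β i → pos x < α i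
  before-arc {i} {x} out x≤β with locate i x
  ... | before x<α _   = x<α
  ... | inside _ _ arc = contradiction (trans (sym arc) out) λ ()
  ... | after β<x _    = contradiction β<x (ℕ.≤⇒≯ x≤β)

  after-arc : ∀ {i x} → arc i x ≡ false → α i ≤ pos x → β i < pos x
  after-arc {i} {x} out α≤x with locate i x
  ... | before x<α _   = contradiction x<α (ℕ.≤⇒≯ α≤x)
  ... | inside _ _ arc = contradiction (trans (sym arc) out) λ ()
  ... | after β<x _    = β<x

  within-arc : ∀ {i x} → arc i x ≡ true → α i ≤ pos x × pos x ≤ β i
  within-arc {i} {x} arc with locate i x
  ... | before _ out     = contradiction (trans (sym arc) out) λ ()
  ... | inside α≤x x≤β _ = α≤x , x≤β
  ... | after _ out      = contradiction (trans (sym arc) out) λ ()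

  module _ {i : Fin s} {u v : Fin n} (u∉ : arc i u ≡ false) (v∉ : arc i v ≡ false) where

    between-arc : ∀ {x} → Between u v i → arc i x ≡ true → pos u < pos x × pos x < pos v
    between-arc (u<α , α<v) arc =
      let α≤x , x≤β = within-arc arc
      in ℕ.<-≤-trans u<α α≤x , ℕ.≤-<-trans x≤β (after-arc v∉ (ℕ.<⇒≤ α<v))

    outside-arc : ∀ {x} → ¬ Between u v i → arc i x ≡ true → pos x < pos u ⊎ pos v < pos x
    outside-arc ¬btw arc with within-arc arc | ℕ.≤-<-connex (α i) (pos u) | ℕ.≤-<-connex (pos v) (α i)
    ... | α≤x , x≤β | inj₁ α≤u | _        = inj₁ (ℕ.≤-<-trans x≤β (after-arc u∉ α≤u))
    ... | α≤x , x≤β | inj₂ _   | inj₁ v≤α =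
      inj₂ (ℕ.<-≤-trans (before-arc v∉ (ℕ.≤-trans v≤α (a≤b i))) α≤x)
    ... | _         | inj₂ u<α | inj₂ α<v = contradiction (u<α , α<v) ¬btw

  -- An interval on each side of the chord makes both parts of a split shorter than `T`.
  Separates : List (Fin s) → Fin n → Fin n → Set
  Separates T u v = pos u < pos v × (∃ λ k → k ∈ˡ T × Between u v k) × (∃ λ l → l ∈ˡ T × ¬ Between u v l)

  -- Going from `u` to `v`, one leaves the gap across interval `j` in the forward direction and
  -- across interval `i` in the backward one. The two intervals thus lie on opposite sides of the
  -- chord; only the order of `u` and `v` from the origin varies.
  gap-separates : ∀ {T i j u v} → i ∈ˡ T → j ∈ˡ T → gap (i , j) u ≡ true → gap (i , j) v ≡ false →
    union T u ≡ false → union T v ≡ false → Separates T u v ⊎ Separates T v u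
  gap-separates {T} {i} {j} {u} {v} i∈ j∈ gu gv u∉ v∉ with locate-gap i j u | locate-gap i j v
  ... | left _ _ g     | _ = contradiction (trans (sym gu) g) λ ()
  ... | right _ _ g    | _ = contradiction (trans (sym gu) g) λ ()
  ... | middle _ _ _ g | _ = contradiction (trans (sym gu) g) λ ()
  ... | _ | between _ _ _ g = contradiction (trans (sym g) gv) λ ()
  ... | _ | start _ _ g     = contradiction (trans (sym g) gv) λ ()
  ... | _ | end _ _ g       = contradiction (trans (sym g) gv) λ ()
  ... | between i<j β<u u<α _ | left _ v≤β _ =
    let v<α = before-arc (union-false v∉ i∈) v≤β ; α<u = ℕ.≤-<-trans (a≤b i) β<u
    in inj₂ (ℕ.<-trans v<α α<u , (i , i∈ , v<α , α<u) , (j , j∈ , λ (_ , α<u) → ℕ.<-asym u<α α<u))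
  ... | between i<j β<u u<α _ | right _ α≤v _ =
    let α<v = ℕ.≤-<-trans (a≤b j) (after-arc (union-false v∉ j∈) α≤v)
    in inj₁ (ℕ.<-trans u<α α<v , (j , j∈ , u<α , α<v) ,
         (i , i∈ , λ (u<α , _) → ℕ.<-asym u<α (ℕ.≤-<-trans (a≤b i) β<u)))
  ... | between i<j _ _ _ | middle j≤i _ _ _ = contradiction i<j (ℕ.≤⇒≯ j≤i)
  ... | start j≤i _ _ | left i<j _ _  = contradiction i<j (ℕ.≤⇒≯ j≤i)
  ... | start j≤i _ _ | right i<j _ _ = contradiction i<j (ℕ.≤⇒≯ j≤i)
  ... | end j≤i _ _   | left i<j _ _  = contradiction i<j (ℕ.≤⇒≯ j≤i)
  ... | end j≤i _ _   | right i<j _ _ = contradiction i<j (ℕ.≤⇒≯ j≤i)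
  ... | start _ u<α _ | middle _ α≤v v≤β _ =
    let α<v = ℕ.≤-<-trans (a≤b j) (after-arc (union-false v∉ j∈) α≤v)
    in inj₁ (ℕ.<-trans u<α α<v , (j , j∈ , u<α , α<v) ,
         (i , i∈ , λ (_ , α<v) → ℕ.<-asym (before-arc (union-false v∉ i∈) v≤β) α<v))
  ... | end _ β<u _ | middle _ α≤v v≤β _ =
    let v<α = before-arc (union-false v∉ i∈) v≤β ; α<u = ℕ.≤-<-trans (a≤b i) β<u
    in inj₂ (ℕ.<-trans v<α α<u , (i , i∈ , v<α , α<u) , (j , j∈ , λ (v<α , _) → ℕ.≤⇒≯ α≤v v<α))

  union-split : ∀ {P : Fin s → Set} (P? : Unary.Decidable P) {T} → AllPairs Fin._<_ T → ∀ x →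
    χ (union T x) ≡ χ (union (filter P? T) x) + χ (union (filter (¬? ∘ P?) T) x)
  union-split P? {T} T! x = begin
    χ (union T x)                     ≡⟨ arcs-total T x T! ⟨
    total c T                         ≡⟨ total-filter P? c T ⟩
    total c (filter P? T) + total c (filter (¬? ∘ P?) T)
      ≡⟨ cong₂ _+_ (arcs-total _ x (AllPairs.filter⁺ P? T!)) (arcs-total _ x (AllPairs.filter⁺ (¬? ∘ P?) T!)) ⟩
    χ (union (filter P? T) x) + χ (union (filter (¬? ∘ P?) T) x) ∎
    where
    open ≡-Reasoning
    c = λ k → χ (arc k x)

  -- Splitting the rank along a chord

  module _ {T : List (Fin s)} (T! : AllPairs Fin._<_ T) where
    open Optimal (union T) (rank T) (maxOn-upper (union T))

    optimal-basis : ∃ IsOptimal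
    optimal-basis = maxOn-attained (union T)

    crossing-free : ∀ {x y u v W W′} →
      union T x ≡ true → union T y ≡ true → union T u ≡ false → union T v ≡ false →
      IsOptimal (x ∷ W) → IsOptimal (y ∷ W) → IsOptimal (u ∷ W′) → IsOptimal (v ∷ W′) →
      pos u < pos x → pos x < pos v → ¬ (pos y < pos u ⊎ pos v < pos y)
    crossing-free {x} {y} {u} {v} Ex Ey Eu Ev xW yW uW vW u<x x<v outside =
      let Z , xu , xv , yu , yv = square Ex Ey Eu Ev xW yW uW vW
      in violation xu (proj₁ xv) (proj₁ yu) (proj₁ yv)
      where
      violation : ∀ {Z} → IsOptimal (x ∷ u ∷ Z) → IsBasis (x ∷ v ∷ Z) → IsBasis (y ∷ u ∷ Z) → IsBasis (y ∷ v ∷ Z) → ⊥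
      violation {Z} (xu , eq) xv yu yv = ℕ.<-irrefl refl (begin-strict
        1 + count (union T) Z             <⟨ ℕ.n<1+n _ ⟩
        2 + count (union T) Z             ≡⟨ cong₂ (λ s t → χ s + (χ t + count (union T) Z)) Ex Ey ⟨
        count (union T) (x ∷ y ∷ Z)       ≤⟨ maxOn-upper (union T) (xy outside) ⟩
        rank T                            ≡⟨ eq ⟨
        count (union T) (x ∷ u ∷ Z)       ≡⟨ cong₂ (λ s t → χ s + (χ t + count (union T) Z)) Ex Eu ⟩
        1 + count (union T) Z             ∎)
        where
        open ℕ.≤-Reasoning
        -- `u` and `v` separate `x` from `y`, so the four bases are the sides of a quadrilateral
        -- with diagonal `x`, `y`.
        xy : pos y < pos u ⊎ pos v < pos y → IsBasis (x ∷ y ∷ Z)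
        xy (inj₁ y<u) = IsBasis-swap (proj₁
          (cyclic-diagonal {y} {u} {x} {v} {Z} y<u u<x x<v yu (IsBasis-swap xu) xv yv))
        xy (inj₂ v<y) = proj₂
          (cyclic-diagonal {u} {x} {v} {y} {Z} u<x x<v v<y (IsBasis-swap xu) xv (IsBasis-swap yv) (IsBasis-swap yu))

    module _ {u v : Fin n} {W : List (Fin n)} (Eu : union T u ≡ false) (Ev : union T v ≡ false)
      (uW : IsOptimal (u ∷ W)) (vW : IsOptimal (v ∷ W)) where

      private
        inner = filter (between? u v) T
        outer = filter (¬? ∘ between? u v) T
        split = union-split (between? u v) T!

      split-⊆ : ∀ {x} → union inner x ≡ true ⊎ union outer x ≡ true → union T x ≡ true
      split-⊆ {x} = χ-summand (split x)

      -- An exchange leaving the inner part stays within the union, so it ends in the outer part, on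
      -- the other side of the chord; `crossing-free` excludes this.
      no-crossing : ¬ Crossing (union inner)
      no-crossing (x , y , W′ , x∈ , y∉ , same , xW , yW) =
        let i , i∈ , arc-x = union-true inner x∈
            k , k∈ , arc-y = union-true outer (χ-remainder (split y) (trans (sym same) Ex) y∉)
            i∈T , btw      = ∈-filter⁻ (between? u v) {xs = T} i∈
            k∈T , ¬btw     = ∈-filter⁻ (¬? ∘ between? u v) {xs = T} k∈
            u<x , x<v      = between-arc (union-false Eu i∈T) (union-false Ev i∈T) btw arc-x
        in crossing-free Ex (trans (sym same) Ex) Eu Ev xW yW uW vW u<x x<v
             (outside-arc (union-false Eu k∈T) (union-false Ev k∈T) ¬btw arc-y)
        where
        Ex = split-⊆ (inj₁ x∈)

      count-parts : ∀ c → count (union T) c ≡ count (union inner) c + count (union outer) c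
      count-parts = count-split {S = union T} {union inner} {union outer} split

      -- Let optimal bases `B` and `B′` attain the inner and the outer rank. If `rank T` were
      -- smaller than the sum, `B′` would have fewer inner elements than `B`, and some exchange
      -- would cross.
      rank-split : rank T ≡ rank inner + rank outer
      rank-split = ℕ.≤-antisym subadditive (ℕ.≮⇒≥ λ lt → no-crossing (crossing lt))
        where
        open ℕ.≤-Reasoning
        subadditive : rank T ≤ rank inner + rank outer
        subadditive = let c , bc , eq = optimal-basis in begin
          rank T                                       ≡⟨ eq ⟨
          count (union T) c                            ≡⟨ count-parts c ⟩
          count (union inner) c + count (union outer) c
            ≤⟨ ℕ.+-mono-≤ (maxOn-upper (union inner) bc) (maxOn-upper (union outer) bc) ⟩
          rank inner + rank outer                      ∎
        crossing : rank T < rank inner + rank outer → Crossing (union inner)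
        crossing lt =
          let c , bc , eq     = maxOn-attained (union inner)
              c′ , bc′ , eq′  = maxOn-attained (union outer)
              B , optB , le   = extend-max (union inner) (split-⊆ ∘ inj₁) bc (proj₂ optimal-basis)
              B′ , optB′ , le′ = extend-max (union outer) (split-⊆ ∘ inj₂) bc′ (proj₂ optimal-basis)
          in nonconstant⇒crossing (union inner) optB optB′ (ℕ.+-cancelʳ-< (rank outer) _ _ (begin-strict
            count (union inner) B′ + rank outer             ≡⟨ cong (λ t → count (union inner) B′ + t) eq′ ⟨
            count (union inner) B′ + count (union outer) c′ ≤⟨ ℕ.+-monoʳ-≤ (count (union inner) B′) le′ ⟩
            count (union inner) B′ + count (union outer) B′ ≡⟨ count-parts B′ ⟨
            count (union T) B′                              ≡⟨ proj₂ optB′ ⟩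
            rank T                                          <⟨ lt ⟩
            rank inner + rank outer                         ≡⟨ cong (_+ rank outer) eq ⟨
            count (union inner) c + rank outer              ≤⟨ ℕ.+-monoˡ-≤ (rank outer) le ⟩
            count (union inner) B + rank outer              ∎))

  Splits : List (Fin s) → Set
  Splits T = ∃ λ u → ∃ λ v → (∃ λ k → k ∈ˡ T × Between u v k) × (∃ λ l → l ∈ˡ T × ¬ Between u v l) ×
    rank T ≡ rank (filter (between? u v) T) + rank (filter (¬? ∘ between? u v) T)

  min-gap : Fin s × Fin s → ℕ
  min-gap p = minOn (gap p)

  nbd′ : List (Fin s) → ℤ
  nbd′ T = + d ℤ.- + total min-gap (cyclicPairs T)

  rank≡nbd′ : ∀ T → rank T + total min-gap (cyclicPairs T) ≡ d → + rank T ≡ nbd′ T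
  rank≡nbd′ T eq = sym (begin
    + d ℤ.- + G                   ≡⟨ cong (λ m → + m ℤ.- + G) eq ⟨
    + (rank T + G) ℤ.- + G        ≡⟨ cong (ℤ._- + G) (ℤ.pos-+ (rank T) G) ⟩
    (+ rank T ℤ.+ + G) ℤ.- + G    ≡⟨ ℤ.+-assoc (+ rank T) (+ G) (ℤ.- (+ G)) ⟩
    + rank T ℤ.+ (+ G ℤ.- + G)    ≡⟨ cong (λ z → + rank T ℤ.+ z) (ℤ.+-inverseʳ (+ G)) ⟩
    + rank T ℤ.+ + 0              ≡⟨ ℤ.+-identityʳ (+ rank T) ⟩
    + rank T                      ∎)
    where
    open ≡-Reasoning
    G = total min-gap (cyclicPairs T)

  count-partition : ∀ i T → AllPairs Fin._<_ (i ∷ T) → ∀ c →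
    count (union (i ∷ T)) c + total (λ p → count (gap p) c) (cyclicPairs (i ∷ T)) ≡ length c
  count-partition i T T! []      = total-zero (cyclicPairs (i ∷ T))
  count-partition i T T! (x ∷ c) = begin
    (χ (union (i ∷ T) x) + count (union (i ∷ T)) c) + total (λ p → χ (gap p x) + count (gap p) c) ps
      ≡⟨ cong (λ z → χ (union (i ∷ T) x) + count (union (i ∷ T)) c + z) (total-+ (λ p → χ (gap p x)) (λ p → count (gap p) c) ps) ⟩
    (χ (union (i ∷ T) x) + count (union (i ∷ T)) c) + (total (λ p → χ (gap p x)) ps + total (λ p → count (gap p) c) ps)
      ≡⟨ interchange (χ (union (i ∷ T) x)) (count (union (i ∷ T)) c) _ _ ⟩
    (χ (union (i ∷ T) x) + total (λ p → χ (gap p x)) ps) + (count (union (i ∷ T)) c + total (λ p → count (gap p) c) ps)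
      ≡⟨ cong₂ _+_ (union+gaps i T x T!) (count-partition i T T! c) ⟩
    suc (length c) ∎
    where
    open ≡-Reasoning
    ps = cyclicPairs (i ∷ T)

  gap-outside : ∀ {i T p x} → AllPairs Fin._<_ (i ∷ T) → p ∈ˡ cyclicPairs (i ∷ T) →
    union (i ∷ T) x ≡ true → gap p x ≡ false
  gap-outside {i} {T} {p} {x} T! p∈ Ex with gap p x in eq
  ... | false = refl
  ... | true  = contradiction (begin
      2                                    ≡⟨ cong₂ (λ s t → χ s + χ t) Ex eq ⟨
      χ (union (i ∷ T) x) + χ (gap p x)    ≤⟨ ℕ.+-monoʳ-≤ (χ (union (i ∷ T) x)) (≤-total (λ p → χ (gap p x)) p∈) ⟩
      χ (union (i ∷ T) x) + total (λ p → χ (gap p x)) (cyclicPairs (i ∷ T)) ≡⟨ union+gaps i T x T! ⟩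
      1                                    ∎) (ℕ.<-irrefl refl)
    where open ℕ.≤-Reasoning

  module _ {i : Fin s} {T : List (Fin s)} (T! : AllPairs Fin._<_ (i ∷ T)) where
    open Optimal (union (i ∷ T)) (rank (i ∷ T)) (maxOn-upper (union (i ∷ T)))

    private
      gaps = cyclicPairs (i ∷ T)

    -- `u` lies in a gap, hence outside the union, and `v` is outside with it, so the two exchanged
    -- elements span a chord.
    crossing-splits : ∀ {p} → p ∈ˡ gaps → Crossing (gap p) → Splits (i ∷ T)
    crossing-splits {p} p∈ (u , v , W , gu , gv , same , uW , vW) =
      [ (λ (_ , k , l) → u , v , k , l , rank-split T! Eu Ev uW vW)
      , (λ (_ , k , l) → v , u , k , l , rank-split T! Ev Eu vW uW)
      ]′ (gap-separates (proj₁ (cyclicPairs-∈ p∈)) (proj₂ (cyclicPairs-∈ p∈)) gu gv Eu Ev)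
      where
      Eu : union (i ∷ T) u ≡ false
      Eu with union (i ∷ T) u in eq
      ... | false = refl
      ... | true  = contradiction (trans (sym gu) (gap-outside T! p∈ eq)) λ ()
      Ev = trans (sym same) Eu

    -- One optimal basis `B` is tested. If it exceeds the minimum on some gap, `extend-min` turns a
    -- basis attaining that minimum into an optimal one with a smaller count there than `B`.
    dichotomy : + rank (i ∷ T) ≡ nbd′ (i ∷ T) ⊎ Splits (i ∷ T)
    dichotomy = decide (All.all? minimal? gaps)
      where
      B  = proj₁ (optimal-basis T!)
      bB = proj₂ (optimal-basis T!)
      minimal? : Unary.Decidable (λ p → count (gap p) B ≤ min-gap p)
      minimal? p = count (gap p) B ℕ.≤? min-gap p
      decide : Dec (All (λ p → count (gap p) B ≤ min-gap p) gaps) → + rank (i ∷ T) ≡ nbd′ (i ∷ T) ⊎ Splits (i ∷ T)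
      decide (yes all) = inj₁ (rank≡nbd′ (i ∷ T) (begin
        rank (i ∷ T) + total min-gap gaps
          ≡⟨ cong₂ _+_ (sym (proj₂ bB)) (total-cong gaps λ {p} p∈ →
               ℕ.≤-antisym (minOn-lower (gap p) (proj₁ bB)) (All.lookup all p∈)) ⟩
        count (union (i ∷ T)) B + total (λ p → count (gap p) B) gaps
          ≡⟨ count-partition i T T! B ⟩
        length B
          ≡⟨ IsBasis-length (proj₁ bB) ⟩
        d ∎))
        where open ≡-Reasoning
      decide (no ¬all) =
        let p , p∈ , ≰       = find (All.¬All⇒Any¬ minimal? gaps ¬all)
            C , bC , leC     = minOn-attained (gap p)
            C′ , optC′ , leC′ = extend-min (gap p) (gap-outside T! p∈) bC bB
        in inj₂ (crossing-splits p∈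
             (nonconstant⇒crossing (gap p) bB optC′ (ℕ.≤-<-trans (ℕ.≤-trans leC′ leC) (ℕ.≰⇒> ≰))))

  -- The values of blk outside T are irrelevant.
  record Partition (T : List (Fin s)) : Set where
    constructor partition
    field
      p           : ℕ
      blk         : Fin s → Fin p
      surjective  : ∀ j → ∃ λ i → i ∈ˡ T × blk i ≡ j
      noncrossing : ∀ {x y z w} → x ∈ˡ T → y ∈ˡ T → z ∈ˡ T → w ∈ˡ T →
        x Fin.< y → y Fin.< z → z Fin.< w → blk x ≡ blk z → blk y ≡ blk w → blk x ≡ blk y
      rank≡       : + rank T ≡ sumZ (λ j → nbd′ (filter (λ i → blk i Fin.≟ j) T))

  single-block : ∀ i T → + rank (i ∷ T) ≡ nbd′ (i ∷ T) → Partition (i ∷ T)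
  single-block i T eq = partition 1 (λ _ → zero) (λ { zero → i , here refl , refl })
    (λ _ _ _ _ _ _ _ _ _ → refl)
    (trans eq (trans (cong nbd′ (sym (List.filter-all (λ _ → zero Fin.≟ zero) (All.universal (λ _ → refl) (i ∷ T)))))
      (sym (ℤ.+-identityʳ _))))

  -- Gluing noncrossing partitions

  module _ {u v : Fin n} {T : List (Fin s)} where

    private
      P?    = between? u v
      inner = filter P? T
      outer = filter (¬? ∘ P?) T

    -- The starting points increase with the index, so the inner indices are consecutive in `T`, and
    -- an inner block cannot cross an outer one.
    merge : rank T ≡ rank inner + rank outer → Partition inner → Partition outer → Partition T
    merge eq (partition p f f-surj f-nc f-rank) (partition q g g-surj g-nc g-rank) =
      partition (p + q) h h-surj h-nc h-rank
      where
      h : Fin s → Fin (p + q)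
      h i with P? i
      ... | yes _ = f i ↑ˡ q
      ... | no  _ = p ↑ʳ g i

      h-yes : ∀ {i} → Between u v i → h i ≡ f i ↑ˡ q
      h-yes {i} b with P? i
      ... | yes _ = refl
      ... | no ¬b = contradiction b ¬b

      h-no : ∀ {i} → ¬ Between u v i → h i ≡ p ↑ʳ g i
      h-no {i} ¬b with P? i
      ... | yes b = contradiction b ¬b
      ... | no _  = refl

      ↑ˡ≢↑ʳ : ∀ {i j} → i ↑ˡ q ≢ p ↑ʳ j
      ↑ˡ≢↑ʳ {i} {j} e with trans (sym (Fin.splitAt-↑ˡ p i q)) (trans (cong (Fin.splitAt p) e) (Fin.splitAt-↑ʳ p q j))
      ... | ()

      h-left : ∀ {i j} → h i ≡ j ↑ˡ q → Between u v i × f i ≡ j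
      h-left {i} e with P? i
      ... | yes b = b , Fin.↑ˡ-injective q _ _ e
      ... | no  _ = contradiction (sym e) ↑ˡ≢↑ʳ

      h-right : ∀ {i j} → h i ≡ p ↑ʳ j → ¬ Between u v i × g i ≡ j
      h-right {i} e with P? i
      ... | yes _ = contradiction e ↑ˡ≢↑ʳ
      ... | no ¬b = ¬b , Fin.↑ʳ-injective p _ _ e

      h-surj : ∀ j → ∃ λ i → i ∈ˡ T × h i ≡ j
      h-surj j with Fin.splitAt p j in e
      ... | inj₁ j′ = let i , i∈ , fi≡ = f-surj j′ ; i∈T , b = ∈-filter⁻ P? {xs = T} i∈
        in i , i∈T , trans (h-yes b) (trans (cong (_↑ˡ q) fi≡) (Fin.splitAt⁻¹-↑ˡ e))
      ... | inj₂ j′ = let i , i∈ , gi≡ = g-surj j′ ; i∈T , ¬b = ∈-filter⁻ (¬? ∘ P?) {xs = T} i∈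
        in i , i∈T , trans (h-no ¬b) (trans (cong (p ↑ʳ_) gi≡) (Fin.splitAt⁻¹-↑ʳ e))

      convex : ∀ {x y z} → x Fin.< y → y Fin.< z → Between u v x → Between u v z → Between u v y
      convex x<y y<z (u<x , _) (_ , z<v) = ℕ.<-trans u<x (α-mono x<y) , ℕ.<-trans (α-mono y<z) z<v

      h-nc : ∀ {x y z w} → x ∈ˡ T → y ∈ˡ T → z ∈ˡ T → w ∈ˡ T →
        x Fin.< y → y Fin.< z → z Fin.< w → h x ≡ h z → h y ≡ h w → h x ≡ h y
      h-nc {x} {y} {z} {w} x∈ y∈ z∈ w∈ x<y y<z z<w xz yw = by-side (P? x) (P? y)
        where
        by-side : Dec (Between u v x) → Dec (Between u v y) → h x ≡ h y
        by-side (yes bx) (yes by) =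
          let bz , fz≡ = h-left (trans (sym xz) (h-yes bx)) ; bw , fw≡ = h-left (trans (sym yw) (h-yes by))
          in trans (h-yes bx) (trans (cong (_↑ˡ q)
               (f-nc (∈-filter⁺ P? x∈ bx) (∈-filter⁺ P? y∈ by) (∈-filter⁺ P? z∈ bz) (∈-filter⁺ P? w∈ bw)
                 x<y y<z z<w (sym fz≡) (sym fw≡))) (sym (h-yes by)))
        by-side (no ¬bx) (no ¬by) =
          let ¬bz , gz≡ = h-right (trans (sym xz) (h-no ¬bx)) ; ¬bw , gw≡ = h-right (trans (sym yw) (h-no ¬by))
              outer⁺ = ∈-filter⁺ (¬? ∘ P?)
          in trans (h-no ¬bx) (trans (cong (p ↑ʳ_)
               (g-nc (outer⁺ x∈ ¬bx) (outer⁺ y∈ ¬by) (outer⁺ z∈ ¬bz) (outer⁺ w∈ ¬bw)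
                 x<y y<z z<w (sym gz≡) (sym gw≡))) (sym (h-no ¬by)))
        -- `z` shares the block of `x` and is inner, so `y` between them would be inner.
        by-side (yes bx) (no ¬by) = contradiction
          (convex x<y y<z bx (proj₁ (h-left (trans (sym xz) (h-yes bx))))) ¬by
        -- `w` shares the block of `y` and is inner, so `z` between them is inner, yet `z` shares
        -- the block of the outer index `x`.
        by-side (no ¬bx) (yes by) = contradiction
          (convex y<z z<w by (proj₁ (h-left (trans (sym yw) (h-yes by))))) (proj₁ (h-right (trans (sym xz) (h-no ¬bx))))

      inner-block : ∀ j → filter (λ i → h i Fin.≟ (j ↑ˡ q)) T ≡ filter (λ i → f i Fin.≟ j) inner
      inner-block j = filter-refine P? (λ i → h i Fin.≟ (j ↑ˡ q)) (λ i → f i Fin.≟ j)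
        h-left (λ b fi≡ → trans (h-yes b) (cong (_↑ˡ q) fi≡)) T

      outer-block : ∀ j → filter (λ i → h i Fin.≟ (p ↑ʳ j)) T ≡ filter (λ i → g i Fin.≟ j) outer
      outer-block j = filter-refine (¬? ∘ P?) (λ i → h i Fin.≟ (p ↑ʳ j)) (λ i → g i Fin.≟ j)
        h-right (λ ¬b gi≡ → trans (h-no ¬b) (cong (p ↑ʳ_) gi≡)) T

      h-rank : + rank T ≡ sumZ (λ j → nbd′ (filter (λ i → h i Fin.≟ j) T))
      h-rank = begin
        + rank T                         ≡⟨ cong +_ eq ⟩
        + (rank inner + rank outer)      ≡⟨ ℤ.pos-+ (rank inner) (rank outer) ⟩
        + rank inner ℤ.+ + rank outer    ≡⟨ cong₂ ℤ._+_ f-rank g-rank ⟩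
        sumZ (λ j → nbd′ (filter (λ i → f i Fin.≟ j) inner)) ℤ.+ sumZ (λ j → nbd′ (filter (λ i → g i Fin.≟ j) outer))
          ≡⟨ cong₂ ℤ._+_ (sumZ-cong (cong nbd′ ∘ inner-block)) (sumZ-cong (cong nbd′ ∘ outer-block)) ⟨
        sumZ (λ j → nbd′ (filter (λ i → h i Fin.≟ (j ↑ˡ q)) T)) ℤ.+ sumZ (λ j → nbd′ (filter (λ i → h i Fin.≟ (p ↑ʳ j)) T))
          ≡⟨ sumZ-+ p (λ j → nbd′ (filter (λ i → h i Fin.≟ j) T)) ⟨
        sumZ (λ j → nbd′ (filter (λ i → h i Fin.≟ j) T)) ∎
        where open ≡-Reasoning

  -- `k` bounds the length of `T`. Each side of the chord omits an interval that lies on the other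
  -- side, so both calls are on shorter lists.
  decompose : ∀ k {T i} → length T ≤ k → i ∈ˡ T → AllPairs Fin._<_ T → Partition T
  decompose zero    {T = _ ∷ _} () _ _
  decompose (suc k) {i ∷ T} len _ T! = [ single-block i T , recurse ]′ (dichotomy T!)
    where
    recurse : Splits (i ∷ T) → Partition (i ∷ T)
    recurse (u , v , (x , x∈ , bx) , (y , y∈ , ¬by) , eq) = merge {u} {v} eq
      (decompose k (shorter (List.filter-notAll P? (i ∷ T) (lose y∈ ¬by))) (∈-filter⁺ P? x∈ bx) (AllPairs.filter⁺ P? T!))
      (decompose k (shorter (List.filter-notAll Q? (i ∷ T) (lose x∈ (λ ¬bx → ¬bx bx)))) (∈-filter⁺ Q? y∈ ¬by)
        (AllPairs.filter⁺ Q? T!))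
      where
      P? = between? u v
      Q? = ¬? ∘ P?
      shorter : ∀ {m} → m < suc (length T) → m ≤ k
      shorter lt = ℕ.s≤s⁻¹ (ℕ.≤-trans lt len)

-- From the axioms back to matrices

positroid : ∀ {n d} (A : Matrix d n) → TotallyNonneg A → FullRank A → PositroidAxioms n d
positroid A tnn full = record
  { IsBasis        = IsBasis
  ; IsBasis-↭      = D-↭ rows
  ; IsBasis-∉      = IsBasis-∉
  ; IsBasis-length = IsBasis-length
  ; exchange       = D-exchange rows
  ; diagonal       = diagonal tnn
  ; maxOn          = rk A
  ; maxOn-upper    = rk-upper
  ; maxOn-attained = rk-attained
  ; minOn          = minCount A
  ; minOn-lower    = minCount-lower
  ; minOn-attained = minCount-attained
  }
  where
  open Positroid A
  open Rank A full

theorem4p2 : (n d : ℕ) (A : Matrix d n) →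
    TotallyNonneg A → FullRank A → NoLoops A → NoColoops A →
    (s : ℕ) → 1 ≤ s → (a b : Fin s → Fin n) →
    Disjoint a b → CyclicallyOrdered a b →
    ∃ λ (p : ℕ) → ∃ λ (blk : Fin s → Fin p) →
    Surjective blk × NonCrossing blk ×
    (+ rk A (unionCI a b) ≡ sumZ (λ j → nbd A a b (block blk j)))
theorem4p2 n d A tnn full _ _ (suc s) _ a b disjoint (a≤b , b<a) =
  p , blk ,
  (λ j → let i , _ , eq = surjective j in i , eq) ,
  (λ x y z w → noncrossing (∈-allFin x) (∈-allFin y) (∈-allFin z) (∈-allFin w)) ,
  trans (cong +_ (rk-cong unionCI≡union)) (trans rank≡ (sumZ-cong (λ j → nbd′≡nbd (block blk j))))
  where
  open Rank A full using (rk-cong; rk-all)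
  -- With the origin at `a zero`, the two halves of `CyclicallyOrdered` are exactly the order
  -- hypotheses on positions.
  open Arcs (a zero) a b a≤b b<a disjoint using (union; arc)
  open Decomposition (positroid A tnn full) (a zero) a b a≤b b<a disjoint

  open Partition (decompose (length (List.allFin (suc s))) ℕ.≤-refl (∈-allFin zero) (AllPairs.tabulate⁺-< (λ i<j → i<j)))

  unionCI≡union : ∀ x → unionCI a b x ≡ union (List.allFin (suc s)) x
  unionCI≡union x = any-tabulate (λ i → i)
    where
    any-tabulate : ∀ {m} (f : Fin m → Fin (suc s)) → anyF (λ i → arc (f i) x) ≡ union (tabulate f) x
    any-tabulate {zero}  f = refl
    any-tabulate {suc m} f = cong (arc (f zero) x ∨_) (any-tabulate (f ∘ suc))

  nbd′≡nbd : ∀ T → nbd′ T ≡ nbd A a b T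
  nbd′≡nbd T = cong₂ (λ x y → + x ℤ.- y) (sym rk-all) (total≡fold (cyclicPairs T))
    where
    total≡fold : ∀ ps → + total min-gap ps ≡ foldr (λ p r → + mBA A (b (proj₁ p)) (a (proj₂ p)) ℤ.+ r) (+ 0) ps
    total≡fold []       = refl
    total≡fold (p ∷ ps) = trans (ℤ.pos-+ (min-gap p) (total min-gap ps)) (cong (λ z → + min-gap p ℤ.+ z) (total≡fold ps))
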